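{- Let $n\geq 7$ and let $T$ be a tree with $n$ vertices and maximum degree $\Delta$, where $3\leq \Delta\leq n-2$. (i) If $3\leq\Delta\leq\lfloor\frac{n-1}{2}\rfloor$, then $$SO(T)\geq \Delta\sqrt{\Delta^2+4}+\sqrt{8}\,(n-2\Delta-1)+\sqrt{5}\,\Delta,$$ with equality if and only if $T$ is a spider whose hub has degree $\Delta$ and all of whose $\Delta$ legs have length at least $2$. (ii) If $\lfloor\frac{n-1}{2}\rfloor<\Delta\leq n-2$, then $$SO(T)\geq (n-\Delta-1)\sqrt{\Delta^2+4}+(2\Delta-n+1)\sqrt{\Delta^2+1}+\sqrt{5}\,(n-\Delta-1),$$ with equality if and only if $T\cong T_{n,\Delta}$.
   Context: All graphs are finite, simple and undirected; $d_G(v)$ denotes the degree of a vertex $v$ in $G$. The Sombor index of a graph $G$ is $SO(G)=\sum_{uv\in E(G)}\sqrt{d_G(u)^2+d_G(v)^2}$. A spider is a tree with at most one vertex of degree greater than two; such a vertex is called the hub, and a leg is a path from the hub to a leaf. $T_{n,\Delta}$ denotes the tree obtained from the star $S_{\Delta+1}$ (with $\Delta+1$ vertices, center of degree $\Delta$) by attaching one pendant edge to each of $n-\Delta-1$ of its leaves (equivalently, the spider with hub of degree $\Delta$ having $n-\Delta-1$ legs of length $2$ and $2\Delta-n+1$ legs of length $1$). -}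

module Defs where

open import Data.Nat using (ℕ; zero; suc; _+_; _*_; _∸_; _≤_; _<_; _≤ᵇ_; _≡ᵇ_)
open import Data.Bool using (Bool; true; false; if_then_else_; _∧_; _∨_)
open import Data.Fin using (Fin; toℕ)
open import Data.Nat.ListAction using (sum)
open import Data.List using (List; []; _∷_; _++_; [_]; map; length; allFin; concatMap; replicate)
open import Data.List.Relation.Unary.Linked using (Linked)
open import Data.List.Relation.Unary.Unique.Propositional using (Unique)
open import Data.Product using (Σ; _×_; ∃; ∃-syntax)
open import Relation.Binary.PropositionalEquality using (_≡_)
open import Relation.Nullary using (¬_)
open import Function.Bundles using (_⤖_; Bijection)

record Graph (n : ℕ) : Set where
  field
    adj   : Fin n → Fin n → Bool
    sym   : ∀ i j → adj i j ≡ adj j i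
    irref : ∀ i → adj i i ≡ false
open Graph public

Adj : ∀ {n} → Graph n → Fin n → Fin n → Set
Adj G i j = adj G i j ≡ true

b2n : Bool → ℕ
b2n true  = 1
b2n false = 0

deg : ∀ {n} → Graph n → Fin n → ℕ
deg {n} G i = sum (map (λ j → b2n (adj G i j)) (allFin n))

edges : ∀ {n} → Graph n → List (Σ (Fin n) (λ _ → Fin n))
edges {n} G = concatMap (λ i → concatMap (λ j →
    if (suc (toℕ i) ≤ᵇ toℕ j) ∧ adj G i j then [ (i Data.Product., j) ] else [])
    (allFin n)) (allFin n)

data Reach {n} (G : Graph n) : Fin n → Fin n → Set where
  here : ∀ {v} → Reach G v v
  step : ∀ {u v w} → Adj G u v → Reach G v w → Reach G u w

Connected : ∀ {n} → Graph n → Set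
Connected G = ∀ u v → Reach G u v

HasCycle : ∀ {n} → Graph n → Set
HasCycle {n} G = ∃[ v ] ∃[ us ] (2 ≤ length us × Unique (v ∷ us)
                   × Linked (Adj G) (v ∷ us ++ [ v ]))

IsTree : ∀ {n} → Graph n → Set
IsTree G = Connected G × ¬ HasCycle G

MaxDegree : ∀ {n} → Graph n → ℕ → Set
MaxDegree G Δ = (∃[ v ] deg G v ≡ Δ) × (∀ v → deg G v ≤ Δ)

IsSpider : ∀ {n} → Graph n → Set
IsSpider G = IsTree G × (∀ u v → 3 ≤ deg G u → 3 ≤ deg G v → u ≡ v)

-- spider whose hub has degree Δ and all legs have length ≥ 2
-- (a leg has length ≥ 2 iff the hub's neighbour on it is not a leaf)
SpiderLongLegs : ∀ {n} → Graph n → ℕ → Set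
SpiderLongLegs G Δ = IsSpider G × ∃[ h ] (deg G h ≡ Δ
                      × (∀ v → Adj G h v → 2 ≤ deg G v))

-- T_{n,Δ}: vertex 0 is the centre, 1..Δ its neighbours,
-- vertex Δ + k is a pendant attached to vertex k (1 ≤ k ≤ n-Δ-1).

adjTℕ : ℕ → ℕ → ℕ → Bool
adjTℕ Δ i j = ((i ≡ᵇ 0) ∧ (1 ≤ᵇ j) ∧ (j ≤ᵇ Δ))
            ∨ ((j ≡ᵇ 0) ∧ (1 ≤ᵇ i) ∧ (i ≤ᵇ Δ))
            ∨ ((1 ≤ᵇ i) ∧ (j ≡ᵇ i + Δ))
            ∨ ((1 ≤ᵇ j) ∧ (i ≡ᵇ j + Δ))

IsoTnΔ : ∀ {n} → Graph n → ℕ → Set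
IsoTnΔ {n} G Δ = Σ (Fin n ⤖ Fin n) λ φ →
  ∀ i j → adj G i j ≡ adjTℕ Δ (toℕ (Bijection.to φ i)) (toℕ (Bijection.to φ j))

-- Finite sums of square roots of naturals, Σ √aᵢ, represented by the
-- list of radicands, with the real order encoded exactly via floor
-- approximations: ⌊N √a⌋ = isqrt (N*N*a).

isqrtGo : ℕ → ℕ → ℕ
isqrtGo zero x = zero
isqrtGo (suc r) x = if suc r * suc r ≤ᵇ x then suc r else isqrtGo r x

isqrt : ℕ → ℕ
isqrt x = isqrtGo x x

RootSum : Set
RootSum = List ℕ

approx : ℕ → RootSum → ℕ
approx N xs = sum (map (λ a → isqrt (N * N * a)) xs)

-- Σ√a ≤ Σ√b  (as real numbers)  iff  ∀ N, Σ⌊N√a⌋ ≤ Σ⌊N√b⌋ + #b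
_≤√_ : RootSum → RootSum → Set
xs ≤√ ys = ∀ N → approx N xs ≤ approx N ys + length ys

_≈√_ : RootSum → RootSum → Set
xs ≈√ ys = (xs ≤√ ys) × (ys ≤√ xs)

SO : ∀ {n} → Graph n → RootSum
SO G = map (λ e → deg G (Data.Product.proj₁ e) * deg G (Data.Product.proj₁ e)
                 + deg G (Data.Product.proj₂ e) * deg G (Data.Product.proj₂ e)) (edges G)

bound1 : ℕ → ℕ → RootSum
bound1 n Δ = replicate Δ (Δ * Δ + 4) ++ replicate (n ∸ 2 * Δ ∸ 1) 8 ++ replicate Δ 5

bound2 : ℕ → ℕ → RootSum
bound2 n Δ = replicate (n ∸ Δ ∸ 1) (Δ * Δ + 4) ++ replicate (2 * Δ + 1 ∸ n) (Δ * Δ + 1)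
             ++ replicate (n ∸ Δ ∸ 1) 5

{-# OPTIONS --safe #-}
module Submission where

-- Root sums are compared through integer approximations at scale N; a bounded error is
-- harmless, so all estimates are made up to a constant independent of N.
--
-- Let h be a vertex of degree Δ, n = Δ + k + 1, and charge weights to darts: with
-- α = √5, δ = √8 − √5, π = √(Δ²+4) − √5 and κ = √(Δ²+1) − √5 + δ, a dart u → v with u ≠ h
-- carries 0, δ or 2δ according as u has degree 1, 2 or at least 3 (but only δ if
-- v = h and deg u ≥ 3), and a dart h → v carries κ if v is a leaf and π otherwise.  Every edge
-- uv satisfies α + w(u,v) + w(v,u) ≤ √(d(u)² + d(v)²) + δ, with equality when both ends
-- are h or have degree at most 2.  A vertex u ≠ h has total weight at least 2δ(d(u) − 1), with a
-- gain of δ if d(u) ≥ 3.  Since the degrees sum to 2(n − 1), this bounds SO(T) below by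
-- a quantity depending only on the number ℓ of leaf neighbours of h, plus δ for every further
-- branch vertex.  As π < κ, this quantity increases with ℓ, and counting degrees gives
-- Δ − ℓ ≤ k; the two cases of the theorem are the extremes ℓ = 0 and ℓ = Δ − k.

open import Defs hiding (sym)
open import Data.Nat
open import Data.Nat.Properties
open import Data.Nat.ListAction using (sum)
open import Data.Nat.ListAction.Properties using (sum-++; sum-↭)
open import Data.Nat.Tactic.RingSolver using (solve-∀)
open import Data.Bool using (true; false; T; Bool; if_then_else_; _∧_; not; _∨_)
open import Data.List using (List; []; _∷_; _++_; map; length; concatMap; [_]; allFin; filter; replicate)
open import Data.List.Properties using (map-++; map-∘; length-tabulate; length-++; length-map)
open import Data.List.Membership.Propositional using (_∈_; _∉_)
open import Data.List.Relation.Unary.Any using (here; there; index)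
open import Data.Product using (_×_; _,_; proj₁; proj₂; ∃-syntax; ∃₂)
open import Data.Unit using (tt)
open import Function using (_∘_)
open import Relation.Nullary using (yes; no; contradiction; ¬_; does)
open import Relation.Binary.PropositionalEquality using (_≡_; _≢_; refl; sym; trans; cong; cong₂; subst; module ≡-Reasoning; setoid)
import Data.Bool.Properties as Bool
open import Data.Fin using (Fin; toℕ; fromℕ<)
import Data.Fin.Properties as Fin
open import Data.List.Membership.Propositional.Properties using (∈-∃++; ∈-++⁺ˡ; ∈-++⁺ʳ; ∈-++⁻; ∈-filter⁺; ∈-filter⁻; ∈-allFin; ∈-map⁻)
open import Data.List.Membership.Propositional.Properties.WithK using (unique∧set⇒bag)
open import Data.List.Relation.Binary.BagAndSetEquality using (∼bag⇒↭)
open import Data.List.Relation.Binary.Permutation.Propositional using (_↭_)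
open import Data.List.Relation.Binary.Permutation.Propositional.Properties using (↭-length; map⁺)
open import Data.List.Relation.Unary.All as All using (All; []; _∷_)
import Data.List.Relation.Unary.All.Properties as All
open import Data.List.Relation.Unary.AllPairs using ([]; _∷_)
open import Data.List.Relation.Unary.Linked using (Linked; []; [-]; _∷_)
open import Data.List.Relation.Unary.Unique.Propositional using (Unique)
open import Data.List.Relation.Unary.Unique.Propositional.Properties using (allFin⁺; filter⁺; ++⁺)
open import Data.Sum using (_⊎_; inj₁; inj₂)
open import Function.Bundles using (mk⇔; _⇔_; Bijection; mk⤖; Equivalence)
open import Relation.Nullary.Decidable using (dec-true; dec-false; ¬?)
open import Relation.Binary.Definitions using (tri<; tri≈; tri>)
open import Data.Nat.DivMod using (m/n*n≤m; m*n/n≡m; /-monoˡ-≤)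
import Data.List.Relation.Unary.Unique.Propositional.Properties as Unique
open import Data.List.Membership.Setoid.Properties using (index-injective)
open import Axiom.UniquenessOfIdentityProofs.WithK using (uip)
open import Function.Definitions using (Injective)

private variable
  A B : Set
  n : ℕ

-- Finite sums over lists

∑ : List A → (A → ℕ) → ℕ
∑ xs f = sum (map f xs)

∑-mono : ∀ (xs : List A) {f g : A → ℕ} → (∀ {x} → x ∈ xs → f x ≤ g x) → ∑ xs f ≤ ∑ xs g
∑-mono []       _ = z≤n
∑-mono (x ∷ xs) p = +-mono-≤ (p (here refl)) (∑-mono xs (p ∘ there))

∑-cong : ∀ (xs : List A) {f g : A → ℕ} → (∀ {x} → x ∈ xs → f x ≡ g x) → ∑ xs f ≡ ∑ xs g
∑-cong []       _ = refl
∑-cong (x ∷ xs) p = cong₂ _+_ (p (here refl)) (∑-cong xs (p ∘ there))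

interchange : ∀ a b c d → (a + b) + (c + d) ≡ (a + c) + (b + d)
interchange = solve-∀

∑-distrib-+ : ∀ (xs : List A) (f g : A → ℕ) → ∑ xs (λ x → f x + g x) ≡ ∑ xs f + ∑ xs g
∑-distrib-+ []       f g = refl
∑-distrib-+ (x ∷ xs) f g =
  trans (cong (f x + g x +_) (∑-distrib-+ xs f g)) (interchange (f x) (g x) (∑ xs f) (∑ xs g))

∑-distrib-* : ∀ (xs : List A) c (f : A → ℕ) → ∑ xs (λ x → c * f x) ≡ c * ∑ xs f
∑-distrib-* []       c f = sym (*-zeroʳ c)
∑-distrib-* (x ∷ xs) c f =
  trans (cong (c * f x +_) (∑-distrib-* xs c f)) (sym (*-distribˡ-+ c (f x) (∑ xs f)))

∑-const : ∀ (xs : List A) c → ∑ xs (λ _ → c) ≡ length xs * c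
∑-const []       c = refl
∑-const (x ∷ xs) c = cong (c +_) (∑-const xs c)

∑-swap : ∀ (xs : List A) (ys : List B) (f : A → B → ℕ) →
         ∑ xs (λ x → ∑ ys (f x)) ≡ ∑ ys (λ y → ∑ xs (λ x → f x y))
∑-swap []       ys f = sym (trans (∑-const ys 0) (*-zeroʳ (length ys)))
∑-swap (x ∷ xs) ys f =
  trans (cong (∑ ys (f x) +_) (∑-swap xs ys f))
        (sym (∑-distrib-+ ys (f x) (λ y → ∑ xs (λ x′ → f x′ y))))

∑-++ : ∀ (xs ys : List A) (f : A → ℕ) → ∑ (xs ++ ys) f ≡ ∑ xs f + ∑ ys f
∑-++ xs ys f = trans (cong sum (map-++ f xs ys)) (sum-++ (map f xs) (map f ys))

∑-map : ∀ (xs : List A) (g : A → B) (f : B → ℕ) → ∑ (map g xs) f ≡ ∑ xs (f ∘ g)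
∑-map xs g f = cong sum (sym (map-∘ {g = f} {f = g} xs))

∑-concatMap : ∀ (xs : List A) (g : A → List B) (f : B → ℕ) →
              ∑ (concatMap g xs) f ≡ ∑ xs (λ x → ∑ (g x) f)
∑-concatMap []       g f = refl
∑-concatMap (x ∷ xs) g f =
  trans (∑-++ (g x) (concatMap g xs) f) (cong (∑ (g x) f +_) (∑-concatMap xs g f))

∈⇒≤∑ : ∀ {xs : List A} {x} (f : A → ℕ) → x ∈ xs → f x ≤ ∑ xs f
∈⇒≤∑ f (here refl) = m≤m+n _ _
∈⇒≤∑ f (there x∈)  = ≤-trans (∈⇒≤∑ f x∈) (m≤n+m _ _)

-- A strict inequality at one entry would survive summation. This turns equality of degree sums into
-- equality of every single degree.
∑-rigid : ∀ (xs : List A) {f g : A → ℕ} → (∀ {x} → x ∈ xs → f x ≤ g x) →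
          ∑ xs g ≤ ∑ xs f → ∀ {x} → x ∈ xs → f x ≡ g x
∑-rigid (x ∷ xs) {f} {g} p q (here refl) = ≤-antisym (p (here refl))
  (+-cancelʳ-≤ (∑ xs f) _ _ (≤-trans (+-monoʳ-≤ (g x) (∑-mono xs (p ∘ there))) q))
∑-rigid (x ∷ xs) {f} {g} p q (there x∈) = ∑-rigid xs (p ∘ there)
  (+-cancelˡ-≤ (g x) _ _ (≤-trans q (+-monoˡ-≤ (∑ xs f) (p (here refl))))) x∈

-- Floors of square roots

square-cancel-< : ∀ {x y} → x * x < y * y → x < y
square-cancel-< {x} {y} p with x <? y
... | yes q = q
... | no ¬q = contradiction p (≤⇒≯ (*-mono-≤ (≮⇒≥ ¬q) (≮⇒≥ ¬q)))

square-cancel-≤ : ∀ {x y} → x * x ≤ y * y → x ≤ y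
square-cancel-≤ {x} {y} p with x ≤? y
... | yes q = q
... | no ¬q = contradiction p (<⇒≱ (*-mono-< (≰⇒> ¬q) (≰⇒> ¬q)))

isqrtGo-lower : ∀ r x → isqrtGo r x * isqrtGo r x ≤ x
isqrtGo-lower zero    x = z≤n
isqrtGo-lower (suc r) x with suc r * suc r ≤ᵇ x in eq
... | true  = ≤ᵇ⇒≤ _ _ (subst T (sym eq) tt)
... | false = isqrtGo-lower r x

-- The hypothesis is the invariant of the downward search: every candidate above `r` has already
-- been found too large.
isqrtGo-upper : ∀ r x → x < suc r * suc r → x < suc (isqrtGo r x) * suc (isqrtGo r x)
isqrtGo-upper zero    x p = p
isqrtGo-upper (suc r) x p with suc r * suc r ≤ᵇ x in eq
... | true  = p
... | false = isqrtGo-upper r x (≰⇒> λ q → subst T eq (≤⇒≤ᵇ q))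

root : ℕ → ℕ → ℕ
root N a = isqrt (N * N * a)

root-lower : ∀ N a → root N a * root N a ≤ N * N * a
root-lower N a = isqrtGo-lower (N * N * a) (N * N * a)

root-upper : ∀ N a → N * N * a < suc (root N a) * suc (root N a)
root-upper N a = isqrtGo-upper (N * N * a) _ (m≤m*n (suc (N * N * a)) (suc (N * N * a)))

root-mono : ∀ N {a b} → a ≤ b → root N a ≤ root N b
root-mono N {a} {b} a≤b = s≤s⁻¹ (square-cancel-<
  (≤-<-trans (≤-trans (root-lower N a) (*-monoʳ-≤ (N * N) a≤b)) (root-upper N b)))

-- The rational bound p/q ≤ √a scaled by `N`; the successor makes up for what the floor discards. In
-- the opposite direction, `root-≤`, the floor only helps.
≤-root : ∀ p q a → p * p ≤ q * q * a → ∀ N → p * N ≤ q * suc (root N a)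
≤-root p q a h N = square-cancel-≤ (begin
  p * N * (p * N)               ≡⟨ e₁ p N ⟩
  p * p * (N * N)               ≤⟨ *-monoˡ-≤ (N * N) h ⟩
  q * q * a * (N * N)           ≡⟨ e₂ q a (N * N) ⟩
  q * q * (N * N * a)           ≤⟨ *-monoʳ-≤ (q * q) (<⇒≤ (root-upper N a)) ⟩
  q * q * (suc r * suc r)       ≡⟨ e₁ q (suc r) ⟨
  q * suc r * (q * suc r)       ∎)
  where
    open ≤-Reasoning
    r = root N a
    e₁ : ∀ x y → x * y * (x * y) ≡ x * x * (y * y)
    e₁ = solve-∀
    e₂ : ∀ q a m → q * q * a * m ≡ q * q * (m * a)
    e₂ = solve-∀

root-≤ : ∀ p q a → q * q * a ≤ p * p → ∀ N → q * root N a ≤ p * N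
root-≤ p q a h N = square-cancel-≤ (begin
  q * r * (q * r)       ≡⟨ e₁ q r ⟩
  q * q * (r * r)       ≤⟨ *-monoʳ-≤ (q * q) (root-lower N a) ⟩
  q * q * (N * N * a)   ≡⟨ e₂ q a (N * N) ⟨
  q * q * a * (N * N)   ≤⟨ *-monoˡ-≤ (N * N) h ⟩
  p * p * (N * N)       ≡⟨ e₁ p N ⟨
  p * N * (p * N)       ∎)
  where
    open ≤-Reasoning
    r = root N a
    e₁ : ∀ x y → x * y * (x * y) ≡ x * x * (y * y)
    e₁ = solve-∀
    e₂ : ∀ q a m → q * q * a * m ≡ q * q * (m * a)
    e₂ = solve-∀

-- √(Δ² + 4) ≤ √(Δ² + 1) + 1/2, because √(Δ² + 1) ≥ 3
root-gap : ∀ Δ → 3 ≤ Δ → ∀ N →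
           2 * root N (Δ * Δ + 4) ≤ 2 * suc (root N (Δ * Δ + 1)) + N
root-gap Δ 3≤Δ N = square-cancel-≤ (begin
  2 * s * (2 * s)                             ≡⟨ e₁ s ⟩
  4 * (s * s)                                 ≤⟨ *-monoʳ-≤ 4 (root-lower N (Δ * Δ + 4)) ⟩
  -- Adding N² completes the square: the radicands differ by 3, and the resulting 12N² is at most
  -- 4tN because 3N ≤ t.
  4 * (N * N * (Δ * Δ + 4))                   ≤⟨ m≤m+n _ (N * N) ⟩
  4 * (N * N * (Δ * Δ + 4)) + N * N           ≡⟨ e₂ N (Δ * Δ) ⟩
  4 * (N * N * (Δ * Δ + 1)) + 4 * (3 * N) * N + N * N
                                              ≤⟨ +-monoˡ-≤ (N * N) (+-mono-≤
                                                   (*-monoʳ-≤ 4 (<⇒≤ (root-upper N (Δ * Δ + 1))))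
                                                   (*-monoˡ-≤ N (*-monoʳ-≤ 4 3N≤t))) ⟩
  4 * (t * t) + 4 * t * N + N * N             ≡⟨ e₃ t N ⟩
  (2 * t + N) * (2 * t + N)                   ∎)
  where
    open ≤-Reasoning
    s = root N (Δ * Δ + 4)
    t = suc (root N (Δ * Δ + 1))
    e₁ : ∀ s → 2 * s * (2 * s) ≡ 4 * (s * s)
    e₁ = solve-∀
    e₂ : ∀ N d → 4 * (N * N * (d + 4)) + N * N ≡ 4 * (N * N * (d + 1)) + 4 * (3 * N) * N + N * N
    e₂ = solve-∀
    e₃ : ∀ t N → 4 * (t * t) + 4 * t * N + N * N ≡ (2 * t + N) * (2 * t + N)
    e₃ = solve-∀
    3N≤t : 3 * N ≤ t
    3N≤t = ≤-trans (≤-root 3 1 (Δ * Δ + 1)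
      (≤-trans (*-mono-≤ 3≤Δ 3≤Δ) (≤-trans (m≤m+n _ 1) (m≤m+n _ 0))) N) (≤-reflexive (*-identityˡ t))

-- Order of root sums

*-root-≤ : ∀ M N a → M * root N a ≤ root (M * N) a
*-root-≤ M N a = s≤s⁻¹ (square-cancel-< (begin-strict
  M * r * (M * r)          ≡⟨ e₁ M r ⟩
  M * M * (r * r)          ≤⟨ *-monoʳ-≤ (M * M) (root-lower N a) ⟩
  M * M * (N * N * a)      ≡⟨ e₂ M N a ⟩
  M * N * (M * N) * a      <⟨ root-upper (M * N) a ⟩
  suc (root (M * N) a) * suc (root (M * N) a) ∎))
  where
    open ≤-Reasoning
    r = root N a
    e₁ : ∀ x y → x * y * (x * y) ≡ x * x * (y * y)
    e₁ = solve-∀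
    e₂ : ∀ M N a → M * M * (N * N * a) ≡ M * N * (M * N) * a
    e₂ = solve-∀

root-*-≤ : ∀ M N a → root (M * N) a ≤ M * suc (root N a)
root-*-≤ M N a = square-cancel-≤ (begin
  root (M * N) a * root (M * N) a ≤⟨ root-lower (M * N) a ⟩
  M * N * (M * N) * a      ≡⟨ e₂ M N a ⟨
  M * M * (N * N * a)      ≤⟨ *-monoʳ-≤ (M * M) (<⇒≤ (root-upper N a)) ⟩
  M * M * (r * r)          ≡⟨ e₁ M r ⟨
  M * r * (M * r)          ∎)
  where
    open ≤-Reasoning
    r = suc (root N a)
    e₁ : ∀ x y → x * y * (x * y) ≡ x * x * (y * y)
    e₁ = solve-∀
    e₂ : ∀ M N a → M * M * (N * N * a) ≡ M * N * (M * N) * a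
    e₂ = solve-∀

*-approx-≤ : ∀ M N xs → M * approx N xs ≤ approx (M * N) xs
*-approx-≤ M N xs = ≤-trans (≤-reflexive (sym (∑-distrib-* xs M (root N))))
  (∑-mono xs (λ {a} _ → *-root-≤ M N a))

approx-*-≤ : ∀ M N xs → approx (M * N) xs ≤ M * (approx N xs + length xs)
approx-*-≤ M N xs = begin
  approx (M * N) xs                      ≤⟨ ∑-mono xs (λ {a} _ → root-*-≤ M N a) ⟩
  ∑ xs (λ a → M * suc (root N a))        ≡⟨ ∑-distrib-* xs M (suc ∘ root N) ⟩
  M * ∑ xs (λ a → 1 + root N a)          ≡⟨ cong (M *_) (∑-distrib-+ xs (λ _ → 1) (root N)) ⟩
  M * (∑ xs (λ _ → 1) + approx N xs)     ≡⟨ cong (λ z → M * (z + approx N xs))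
                                              (trans (∑-const xs 1) (*-identityʳ _)) ⟩
  M * (length xs + approx N xs)          ≡⟨ cong (M *_) (+-comm (length xs) _) ⟩
  M * (approx N xs + length xs)          ∎
  where open ≤-Reasoning

-- A uniformly bounded error is harmless: replacing N by (K + 1) N magnifies
-- a violation at N by K + 1 but leaves the error K unchanged.
≤√-intro : ∀ xs ys c K → (∀ N → suc c * approx N xs ≤ suc c * approx N ys + K) → xs ≤√ ys
≤√-intro xs ys c K h N with approx N xs ≤? approx N ys + length ys
... | yes p = p
... | no ¬p = contradiction (begin-strict
  suc K * suc Y                       ≤⟨ *-monoʳ-≤ (suc K) (≰⇒> ¬p) ⟩
  suc K * approx N xs                 ≤⟨ *-approx-≤ (suc K) N xs ⟩
  approx (suc K * N) xs               ≤⟨ *-cancelˡ-≤ (suc c) (≤-trans (h (suc K * N))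
                                           (≤-trans (+-monoʳ-≤ _ (m≤m+n K (c * K)))
                                             (≤-reflexive (sym (*-distribˡ-+ (suc c) _ K))))) ⟩
  approx (suc K * N) ys + K           ≤⟨ +-monoˡ-≤ K (approx-*-≤ (suc K) N ys) ⟩
  suc K * Y + K                       <⟨ n<1+n _ ⟩
  suc (suc K * Y + K)                 ≡⟨ e K Y ⟩
  suc K * suc Y                       ∎) (<-irrefl refl)
  where
    open ≤-Reasoning
    Y = approx N ys + length ys
    e : ∀ K Y → suc (suc K * Y + K) ≡ suc K * suc Y
    e = solve-∀

-- A gap growing linearly in `N` cannot hide in a bounded error. This yields the equality cases: `s`
-- will count the defects of a tree.
≤√-no-gap : ∀ xs ys c K s → (∀ N → c * approx N xs + s * N ≤ c * approx N ys + K) →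
            ys ≤√ xs → s ≡ 0
≤√-no-gap xs ys c K zero    h le = refl
≤√-no-gap xs ys c K (suc s) h le = contradiction (begin-strict
  c * X + suc s * N             ≤⟨ h N ⟩
  c * approx N ys + K           ≤⟨ +-monoˡ-≤ K (*-monoʳ-≤ c (le N)) ⟩
  c * (X + length xs) + K       ≡⟨ e c X (length xs) K ⟩
  c * X + (c * length xs + K)   <⟨ +-monoʳ-< (c * X) (n<1+n _) ⟩
  c * X + N                     ≤⟨ +-monoʳ-≤ (c * X) (m≤m+n N (s * N)) ⟩
  c * X + suc s * N             ∎) (<-irrefl refl)
  where
    open ≤-Reasoning
    -- The first scale exceeding the total error, so that a gap of a single `N` is already too
    -- large.
    N = suc (c * length xs + K)
    X = approx N xs
    e : ∀ c X l K → c * (X + l) + K ≡ c * X + (c * l + K)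
    e = solve-∀

-- Counting edges of trees

∉⇒All≢ : ∀ {x : A} {xs} → x ∉ xs → All (x ≢_) xs
∉⇒All≢ x∉ = All.tabulate λ { y∈ refl → x∉ y∈ }

∷-unique : ∀ {x : A} {xs} → x ∉ xs → Unique xs → Unique (x ∷ xs)
∷-unique x∉ u = ∉⇒All≢ x∉ ∷ u

head∉tail : ∀ {x : A} {xs} → Unique (x ∷ xs) → x ∉ xs
head∉tail (px ∷ _) x∈ = All.lookup px x∈ refl

unique-⊆⇒length≤ : ∀ {xs ys : List A} → Unique xs → (∀ {x} → x ∈ xs → x ∈ ys) → length xs ≤ length ys
unique-⊆⇒length≤ {xs = []} _ _ = z≤n
unique-⊆⇒length≤ {xs = x ∷ xs} {ys} u@(_ ∷ uxs) ⊆ with as , bs , refl ← ∈-∃++ (⊆ (here refl)) =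
  ≤-trans (s≤s (unique-⊆⇒length≤ uxs shrink)) (≤-reflexive length-eq)
  where
    shrink : ∀ {y} → y ∈ xs → y ∈ as ++ bs
    shrink {y} y∈ with ∈-++⁻ as (⊆ (there y∈))
    ... | inj₁ y∈as = ∈-++⁺ˡ y∈as
    ... | inj₂ (here refl) = contradiction y∈ (head∉tail u)
    ... | inj₂ (there y∈bs) = ∈-++⁺ʳ as y∈bs
    length-eq : suc (length (as ++ bs)) ≡ length (as ++ x ∷ bs)
    length-eq = trans (cong suc (length-++ as))
      (trans (sym (+-suc (length as) _)) (sym (length-++ as)))

unique-↭ : ∀ {xs ys : List A} → Unique xs → Unique ys →
           (∀ {x} → x ∈ xs → x ∈ ys) → (∀ {x} → x ∈ ys → x ∈ xs) → xs ↭ ys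
unique-↭ uxs uys ⊆ ⊇ = ∼bag⇒↭ (unique∧set⇒bag uxs uys (mk⇔ ⊆ ⊇))

∑-↭ : ∀ {xs ys : List A} (f : A → ℕ) → xs ↭ ys → ∑ xs f ≡ ∑ ys f
∑-↭ f p = sum-↭ (map⁺ f p)

selected : (A → Bool) → List A → List A
selected p = filter (λ x → p x Bool.≟ true)

∑-b2n : ∀ (p : A → Bool) xs → ∑ xs (b2n ∘ p) ≡ length (selected p xs)
∑-b2n p [] = refl
∑-b2n p (x ∷ xs) with p x
... | true  = cong suc (∑-b2n p xs)
... | false = ∑-b2n p xs

∈-selected⁺ : ∀ (p : A → Bool) {x xs} → x ∈ xs → p x ≡ true → x ∈ selected p xs
∈-selected⁺ p = ∈-filter⁺ (λ x → p x Bool.≟ true)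

∈-selected⁻ : ∀ (p : A → Bool) {x xs} → x ∈ selected p xs → x ∈ xs × p x ≡ true
∈-selected⁻ p = ∈-filter⁻ (λ x → p x Bool.≟ true)

∑-b2n-≤ : ∀ (p : A → Bool) {xs ys} → Unique xs →
          (∀ {x} → x ∈ xs → p x ≡ true → x ∈ ys) → ∑ xs (b2n ∘ p) ≤ length ys
∑-b2n-≤ p {xs} u h = ≤-trans (≤-reflexive (∑-b2n p xs))
  (unique-⊆⇒length≤ (filter⁺ _ u) λ x∈ → let x∈xs , px = ∈-selected⁻ p x∈ in h x∈xs px)

≤-∑-b2n : ∀ (p : A → Bool) {xs ys} → Unique ys →
          (∀ {y} → y ∈ ys → y ∈ xs × p y ≡ true) → length ys ≤ ∑ xs (b2n ∘ p)
≤-∑-b2n p {xs} u h = ≤-trans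
  (unique-⊆⇒length≤ u λ y∈ → let y∈xs , py = h y∈ in ∈-selected⁺ p y∈xs py)
  (≤-reflexive (sym (∑-b2n p xs)))

length-allFin : ∀ n → length (allFin n) ≡ n
length-allFin n = length-tabulate (λ i → i)

unique⇒length≤n : ∀ {xs : List (Fin n)} → Unique xs → length xs ≤ n
unique⇒length≤n {n} u =
  ≤-trans (unique-⊆⇒length≤ u λ {x} _ → ∈-allFin x) (≤-reflexive (length-allFin n))

module _ (G : Graph n) where

  private
    e : Fin n → Fin n → ℕ
    e i j = b2n (adj G i j)

  adj-swap : ∀ {u v} → Adj G u v → Adj G v u
  adj-swap {u} {v} = trans (Graph.sym G v u)

  adj⇒≢ : ∀ {u v} → Adj G u v → u ≢ v
  adj⇒≢ {u} a refl with () ← trans (sym a) (irref G u)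

  ≤-deg : ∀ {v ys} → Unique ys → (∀ {y} → y ∈ ys → Adj G v y) → length ys ≤ deg G v
  ≤-deg {v} u h = ≤-∑-b2n (adj G v) u (λ y∈ → ∈-allFin _ , h y∈)

  deg≤1⇒unique-nbr : ∀ {v x y} → deg G v ≤ 1 → Adj G v x → Adj G v y → x ≡ y
  deg≤1⇒unique-nbr {v} {x} {y} d≤1 ax ay with x Fin.≟ y
  ... | yes x≡y = x≡y
  ... | no x≢y = contradiction (≤-trans
    (≤-deg ((x≢y ∷ []) ∷ [] ∷ []) λ { (here refl) → ax ; (there (here refl)) → ay }) d≤1) 1+n≰n

  adj₂⇒2≤deg : ∀ {v x y} → x ≢ y → Adj G v x → Adj G v y → 2 ≤ deg G v
  adj₂⇒2≤deg x≢y ax ay =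
    ≤-deg ((x≢y ∷ []) ∷ [] ∷ []) λ { (here refl) → ax ; (there (here refl)) → ay }

  adj₃⇒3≤deg : ∀ {v x y z} → x ≢ y → x ≢ z → y ≢ z →
               Adj G v x → Adj G v y → Adj G v z → 3 ≤ deg G v
  adj₃⇒3≤deg x≢y x≢z y≢z ax ay az = ≤-deg ((x≢y ∷ x≢z ∷ []) ∷ (y≢z ∷ []) ∷ [] ∷ [])
    λ { (here refl) → ax ; (there (here refl)) → ay ; (there (there (here refl))) → az }

  -- The list omits the start, so `x ∷ us` is the whole vertex sequence; this is the shape in which
  -- `HasCycle` presents a cycle.
  data Path : Fin n → List (Fin n) → Fin n → Set where
    stop : ∀ {x} → Path x [] x
    _∷_  : ∀ {x y z us} → Adj G x y → Path y us z → Path x (y ∷ us) z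

  snoc : ∀ {x us y z} → Path x us y → Adj G y z → Path x (us ++ [ z ]) z
  snoc stop    b = b ∷ stop
  snoc (a ∷ p) b = a ∷ snoc p b

  path-linked : ∀ {x us y z} → Path x us y → Adj G y z → Linked (Adj G) (x ∷ us ++ [ z ])
  path-linked stop    b = b ∷ [-]
  path-linked (a ∷ p) b = a ∷ path-linked p b

  edgeSum : List (Fin n) → ℕ
  edgeSum S = ∑ S λ x → ∑ S (e x)

  -- `count` is the relation |E| = |S| - 1, doubled because `edgeSum` sees every edge from both
  -- ends. `conn` asks for simple paths inside `S`, since these are what a new vertex could close to
  -- a cycle.
  record Subtree (S : List (Fin n)) : Set where
    field
      unique : Unique S
      count  : edgeSum S + 2 ≡ 2 * length S
      conn   : ∀ {x y} → x ∈ S → y ∈ S →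
               ∃[ us ] Path x us y × Unique (x ∷ us) × All (_∈ S) (x ∷ us)
  open Subtree

  singleton : ∀ r → Subtree [ r ]
  singleton r .unique = [] ∷ []
  singleton r .count rewrite irref G r = refl
  singleton r .conn (here refl) (here refl) = [] , stop , [] ∷ [] , here refl ∷ []

  module _ (acyclic : ¬ HasCycle G) where

    -- Two neighbours of v in S would close a cycle through the path joining them in S.
    attached-once : ∀ {S v u u′} → Subtree S → v ∉ S → u ∈ S → u′ ∈ S →
                    Adj G v u → Adj G v u′ → u′ ≡ u
    attached-once {S} {v} {u} {u′} t v∉ u∈ u′∈ a a′ with conn t u∈ u′∈
    ... | [] , stop , _ , _ = refl
    ... | w ∷ us , p , uniq , inS = contradiction
      (v , u ∷ w ∷ us , s≤s (s≤s z≤n) , ∷-unique (λ v∈ → v∉ (All.lookup inS v∈)) uniq ,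
       a ∷ path-linked p (adj-swap a′)) acyclic

    -- The new vertex has exactly one neighbour in `S`, so its row and its column each add 1 to
    -- `edgeSum`, matching the 2 added on the right.
    attach : ∀ {S v u} → Subtree S → v ∉ S → u ∈ S → Adj G v u → Subtree (v ∷ S)
    attach t v∉ u∈ a .unique = ∷-unique v∉ (unique t)
    attach {S} {v} {u} t v∉ u∈ a .count = begin
      e v v + ∑ S (e v) + ∑ S (λ x → e x v + ∑ S (e x)) + 2
        ≡⟨ cong₂ (λ y z → y + ∑ S (e v) + z + 2) (cong b2n (irref G v))
                 (∑-distrib-+ S (λ x → e x v) (λ x → ∑ S (e x))) ⟩
      ∑ S (e v) + (∑ S (λ x → e x v) + edgeSum S) + 2
        ≡⟨ cong (λ z → ∑ S (e v) + (z + edgeSum S) + 2)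
                (∑-cong S (λ {x} _ → cong b2n (Graph.sym G x v))) ⟩
      ∑ S (e v) + (∑ S (e v) + edgeSum S) + 2
        ≡⟨ cong (λ z → z + (z + edgeSum S) + 2) once ⟩
      1 + (1 + edgeSum S) + 2   ≡⟨ cong (2 +_) (count t) ⟩
      2 + 2 * length S          ≡⟨ *-suc 2 (length S) ⟨
      2 * length (v ∷ S)        ∎
      where
        open ≡-Reasoning
        once : ∑ S (e v) ≡ 1
        once = ≤-antisym
          (∑-b2n-≤ (adj G v) {ys = [ u ]} (unique t)
            λ x∈ ax → here (attached-once t v∉ u∈ x∈ a ax))
          (≤-∑-b2n (adj G v) ([] ∷ []) λ { (here refl) → u∈ , a })
    attach t v∉ u∈ a .conn (here refl) (here refl) = [] , stop , [] ∷ [] , here refl ∷ []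
    attach t v∉ u∈ a .conn (here refl) (there y∈) =
      let us , p , uniq , inS = conn t u∈ y∈ in
      _ ∷ us , a ∷ p , ∷-unique (λ v∈ → v∉ (All.lookup inS v∈)) uniq ,
      here refl ∷ All.map there inS
    attach {S} {v} t v∉ u∈ a .conn {x} (there x∈) (here refl) =
      let us , p , uniq , inS = conn t x∈ u∈ in
      us ++ [ v ] , snoc p (adj-swap a) ,
      ++⁺ uniq ([] ∷ []) (λ { (w∈ , here refl) → v∉ (All.lookup inS w∈) }) ,
      All.++⁺ (All.map there inS) (here refl ∷ [])
    attach t v∉ u∈ a .conn (there x∈) (there y∈) =
      let us , p , uniq , inS = conn t x∈ y∈ in us , p , uniq , All.map there inS

    open import Data.List.Membership.DecPropositional (Fin._≟_ {n}) using (_∈?_)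

    -- The first step of the walk that leaves `S` gives the edge.
    boundary : ∀ {S x w} → x ∈ S → w ∉ S → Reach G x w → ∃₂ λ u v → u ∈ S × v ∉ S × Adj G v u
    boundary x∈ w∉ here = contradiction x∈ w∉
    boundary {S} x∈ w∉ (step {v = y} a r) with y ∈? S
    ... | yes y∈ = boundary y∈ w∉ r
    ... | no y∉  = _ , y , x∈ , y∉ , adj-swap a

    -- The subtree absorbs boundary vertices until it spans. `fuel` bounds the number of vertices
    -- still missing: at 0, `S` already holds `n` distinct vertices and none can lie outside.
    grow : Connected G → ∀ fuel {S r} → r ∈ S → Subtree S → n ≤ fuel + length S →
           ∃[ S′ ] Subtree S′ × (∀ v → v ∈ S′)
    grow con fuel {S} {r} r∈ t n≤ with Fin.all? (_∈? S)
    ... | yes all = S , t , all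
    ... | no ¬all with w , w∉ ← Fin.¬∀⟶∃¬ n _ (_∈? S) ¬all
                  with u , v , u∈ , v∉ , a ← boundary r∈ w∉ (con r w) = go fuel n≤
      where
        go : ∀ fuel → n ≤ fuel + length S → ∃[ S′ ] Subtree S′ × (∀ v → v ∈ S′)
        go zero n≤ = contradiction (≤-trans (unique⇒length≤n (∷-unique v∉ (unique t))) n≤) 1+n≰n
        go (suc fuel) n≤ = grow con fuel (there r∈) (attach t v∉ u∈ a)
          (≤-trans n≤ (≤-reflexive (sym (+-suc fuel (length S)))))

  -- A spanning subtree lists every vertex once, so its edge count is the degree sum. `r` is the
  -- vertex from which it grows.
  tree-degree-sum : IsTree G → Fin n → ∑ (allFin n) (deg G) + 2 ≡ 2 * n
  tree-degree-sum (con , acyclic) r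
    with S , t , all ← grow acyclic con n (here refl) (singleton r) (m≤m+n n 1) = begin
    ∑ (allFin n) (deg G) + 2   ≡⟨ cong (_+ 2) (∑-↭ (deg G) p) ⟨
    ∑ S (deg G) + 2            ≡⟨ cong (_+ 2) (∑-cong S λ {x} _ → ∑-↭ (e x) p) ⟨
    edgeSum S + 2              ≡⟨ count t ⟩
    2 * length S               ≡⟨ cong (2 *_) (trans (↭-length p) (length-allFin n)) ⟩
    2 * n                      ∎
    where
      open ≡-Reasoning
      p : S ↭ allFin n
      p = unique-↭ (unique t) (allFin⁺ n) (λ {x} _ → ∈-allFin x) (λ {x} _ → all x)

  1≤deg : Connected G → ∀ {u v} → u ≢ v → 1 ≤ deg G u
  1≤deg con {u} {v} u≢v with con u v
  ... | here = contradiction refl u≢v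
  ... | step a _ = ≤-deg ([] ∷ []) λ { (here refl) → a }

  -- From either of two adjacent leaves the only step leads to the other, so their edge is a whole
  -- component.
  adjacent-leaves⇒all : ∀ {u v} → Adj G u v → deg G u ≤ 1 → deg G v ≤ 1 →
                        ∀ {w} → Reach G u w → w ≡ u ⊎ w ≡ v
  adjacent-leaves⇒all a du dv here = inj₁ refl
  adjacent-leaves⇒all a du dv (step b r) with refl ← deg≤1⇒unique-nbr du a b
    with adjacent-leaves⇒all (adj-swap a) dv du r
  ... | inj₁ eq = inj₂ eq
  ... | inj₂ eq = inj₁ eq

  no-adjacent-leaves : Connected G → ∀ {h u v} → 2 ≤ deg G h → Adj G u v →
                       deg G u ≤ 1 → deg G v ≤ 1 → ∀ {C : Set} → C
  no-adjacent-leaves con {h} {u} dh a du dv with adjacent-leaves⇒all a du dv (con u h)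
  ... | inj₁ refl = contradiction (≤-trans dh du) 1+n≰n
  ... | inj₂ refl = contradiction (≤-trans dh dv) 1+n≰n

-- Weights of darts

module Weights (Δ N : ℕ) (3≤Δ : 3 ≤ Δ) where

  α δ π κ : ℕ
  α = root N 5
  δ = root N 8 ∸ α
  π = root N (Δ * Δ + 4) ∸ α
  κ = (root N (Δ * Δ + 1) ∸ α) + δ

  -- An edge from the hub to a branch vertex is estimated by √(Δ² + 4) alone, since √(Δ² + 9) comes
  -- arbitrarily close to it as Δ grows; hence the reduced weight of a dart from a branch vertex to
  -- the hub. Degree 0 gets a default value.
  weight : (u-hub v-hub : Bool) (du dv : ℕ) → ℕ
  weight true  _     _ dv = if 2 ≤ᵇ dv then π else κ
  weight false _     0 _ = 0
  weight false _     1 _ = 0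
  weight false _     2 _ = δ
  weight false true  (suc (suc (suc _))) _ = δ
  weight false false (suc (suc (suc _))) _ = 2 * δ

  private
    9≤Δ² : 9 ≤ Δ * Δ
    9≤Δ² = *-mono-≤ 3≤Δ 3≤Δ

    α≤ : ∀ {a} → 5 ≤ a → α ≤ root N a
    α≤ = root-mono N

  -- Here and in the next two identities the truncated subtraction is exact, because the radicands
  -- are at least 5.
  α+δ : α + δ ≡ root N 8
  α+δ = m+[n∸m]≡n (α≤ (m≤m+n 5 3))

  α+π : α + π ≡ root N (Δ * Δ + 4)
  α+π = m+[n∸m]≡n (α≤ (≤-trans (m≤m+n 5 4) (≤-trans 9≤Δ² (m≤m+n _ 4))))

  α+κ : α + κ ≡ root N (Δ * Δ + 1) + δ
  α+κ = trans (sym (+-assoc α _ δ))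
    (cong (_+ δ) (m+[n∸m]≡n (α≤ (≤-trans (m≤m+n 5 4) (≤-trans 9≤Δ² (m≤m+n _ 1))))))

  -- 20√5 ≤ 45 and 56 ≤ 20√8
  11N≤20δ : 11 * N ≤ 20 * δ + 20
  11N≤20δ = +-cancelˡ-≤ (45 * N) _ _ (begin
    45 * N + 11 * N          ≡⟨ *-distribʳ-+ N 45 11 ⟨
    56 * N                   ≤⟨ ≤-root 56 20 8 (≤ᵇ⇒≤ 3136 3200 _) N ⟩
    20 * suc (root N 8)      ≡⟨ cong (λ z → 20 * suc z) α+δ ⟨
    20 * suc (α + δ)         ≡⟨ e α δ ⟩
    20 * α + (20 * δ + 20)   ≤⟨ +-monoˡ-≤ _ (root-≤ 45 20 5 (≤ᵇ⇒≤ 2000 2025 _) N) ⟩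
    45 * N + (20 * δ + 20)   ∎)
    where
      open ≤-Reasoning
      e : ∀ a d → 20 * suc (a + d) ≡ 20 * a + (20 * d + 20)
      e = solve-∀

  -- Per unit of scale, κ - π = δ - (√(Δ² + 4) - √(Δ² + 1)) is at least 11/20 - 1/2 = 1/20. So a
  -- leaf next to the hub in place of an inner neighbour raises the hub's weight by `N`/20, up to
  -- rounding.
  π-κ-gap : 20 * π + N ≤ 20 * κ + 40
  π-κ-gap = +-cancelˡ-≤ (20 * α) _ _ (begin
    20 * α + (20 * π + N)             ≡⟨ e₁ α π N ⟩
    10 * (2 * (α + π)) + N            ≡⟨ cong (λ z → 10 * (2 * z) + N) α+π ⟩
    10 * (2 * root N (Δ * Δ + 4)) + N ≤⟨ +-monoˡ-≤ N (*-monoʳ-≤ 10 (root-gap Δ 3≤Δ N)) ⟩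
    10 * (2 * suc q + N) + N          ≡⟨ e₂ q N ⟩
    20 * q + 20 + 11 * N              ≤⟨ +-monoʳ-≤ (20 * q + 20) 11N≤20δ ⟩
    20 * q + 20 + (20 * δ + 20)       ≡⟨ e₃ q δ ⟩
    20 * (q + δ) + 40                 ≡⟨ cong (λ z → 20 * z + 40) α+κ ⟨
    20 * (α + κ) + 40                 ≡⟨ e₄ α κ ⟩
    20 * α + (20 * κ + 40)            ∎)
    where
      open ≤-Reasoning
      q = root N (Δ * Δ + 1)
      e₁ : ∀ a p N → 20 * a + (20 * p + N) ≡ 10 * (2 * (a + p)) + N
      e₁ = solve-∀
      e₂ : ∀ q N → 10 * (2 * suc q + N) + N ≡ 20 * q + 20 + 11 * N
      e₂ = solve-∀
      e₃ : ∀ q d → 20 * q + 20 + (20 * d + 20) ≡ 20 * (q + d) + 40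
      e₃ = solve-∀
      e₄ : ∀ a k → 20 * (a + k) + 40 ≡ 20 * a + (20 * k + 40)
      e₄ = solve-∀

  private
    -- 2√8 ≤ √13 + √5, via 57/20, 72/20 and 44/20
    roots-13 : α + 2 * δ ≤ root N 13 + 3
    roots-13 = *-cancelˡ-≤ 20 (+-cancelˡ-≤ (20 * α) _ _ (begin
      20 * α + 20 * (α + 2 * δ)     ≡⟨ e₁ α δ ⟩
      2 * (20 * (α + δ))            ≡⟨ cong (λ z → 2 * (20 * z)) α+δ ⟩
      2 * (20 * root N 8)           ≤⟨ *-monoʳ-≤ 2 (root-≤ 57 20 8 (≤ᵇ⇒≤ 3200 3249 _) N) ⟩
      2 * (57 * N)                  ≤⟨ m≤m+n _ (2 * N) ⟩
      2 * (57 * N) + 2 * N          ≡⟨ e₂ N ⟩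
      72 * N + 44 * N               ≤⟨ +-mono-≤ (≤-root 72 20 13 (≤ᵇ⇒≤ 5184 5200 _) N)
                                                (≤-root 44 20 5 (≤ᵇ⇒≤ 1936 2000 _) N) ⟩
      20 * suc (root N 13) + 20 * suc α    ≤⟨ m≤m+n _ 20 ⟩
      20 * suc (root N 13) + 20 * suc α + 20 ≡⟨ e₃ (root N 13) α ⟩
      20 * α + 20 * (root N 13 + 3) ∎))
      where
        open ≤-Reasoning
        e₁ : ∀ a d → 20 * a + 20 * (a + 2 * d) ≡ 2 * (20 * (a + d))
        e₁ = solve-∀
        e₂ : ∀ N → 2 * (57 * N) + 2 * N ≡ 72 * N + 44 * N
        e₂ = solve-∀
        e₃ : ∀ r a → 20 * suc r + 20 * suc a + 20 ≡ 20 * a + 20 * (r + 3)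
        e₃ = solve-∀

    -- 3√8 ≤ √18 + 2√5, via 57/20, 84/20 and 44/20
    roots-18 : α + 3 * δ ≤ root N 18 + 3
    roots-18 = *-cancelˡ-≤ 20 (+-cancelˡ-≤ (40 * α) _ _ (begin
      40 * α + 20 * (α + 3 * δ)     ≡⟨ e₁ α δ ⟩
      3 * (20 * (α + δ))            ≡⟨ cong (λ z → 3 * (20 * z)) α+δ ⟩
      3 * (20 * root N 8)           ≤⟨ *-monoʳ-≤ 3 (root-≤ 57 20 8 (≤ᵇ⇒≤ 3200 3249 _) N) ⟩
      3 * (57 * N)                  ≤⟨ m≤m+n _ N ⟩
      3 * (57 * N) + N              ≡⟨ e₂ N ⟩
      84 * N + 2 * (44 * N)         ≤⟨ +-mono-≤ (≤-root 84 20 18 (≤ᵇ⇒≤ 7056 7200 _) N)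
                                        (*-monoʳ-≤ 2 (≤-root 44 20 5 (≤ᵇ⇒≤ 1936 2000 _) N)) ⟩
      20 * suc (root N 18) + 2 * (20 * suc α)    ≡⟨ e₃ (root N 18) α ⟩
      40 * α + 20 * (root N 18 + 3) ∎))
      where
        open ≤-Reasoning
        e₁ : ∀ a d → 40 * a + 20 * (a + 3 * d) ≡ 3 * (20 * (a + d))
        e₁ = solve-∀
        e₂ : ∀ N → 3 * (57 * N) + N ≡ 84 * N + 2 * (44 * N)
        e₂ = solve-∀
        e₃ : ∀ r a → 20 * suc r + 2 * (20 * suc a) ≡ 40 * a + 20 * (r + 3)
        e₃ = solve-∀

    9≤ : ∀ d → 9 ≤ suc (suc (suc d)) * suc (suc (suc d))
    9≤ d = *-mono-≤ {3} {3 + d} {3} {3 + d} (m≤m+n 3 d) (m≤m+n 3 d)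

    ≡⇒≤+3 : ∀ {x y} → x ≡ y → x ≤ y + 3
    ≡⇒≤+3 {x} refl = m≤m+n x 3

    +-swap-right : ∀ x y z → x + y + z ≡ x + z + y
    +-swap-right = solve-∀

  edge-12 : α + 0 + δ ≡ root N 5 + δ
  edge-12 = cong (_+ δ) (+-identityʳ α)

  edge-22 : α + δ + δ ≡ root N 8 + δ
  edge-22 = cong (_+ δ) α+δ

  edge-hub-leaf : α + κ + 0 ≡ root N (Δ * Δ + 1) + δ
  edge-hub-leaf = trans (+-identityʳ (α + κ)) α+κ

  edge-hub-2 : α + π + δ ≡ root N (Δ * Δ + 4) + δ
  edge-hub-2 = cong (_+ δ) α+π

  -- After cancelling δ, the bounds for edges with a branch end ask that √8, 2√8 - √5 and 3√8 - 2√5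
  -- be at most √a when the other end has degree 1, 2 and at least 3, respectively.
  edge-13 : ∀ {a} → 8 ≤ a → α + 0 + 2 * δ ≤ root N a + δ + 3
  edge-13 {a} 8≤a = begin
    α + 0 + 2 * δ    ≡⟨ e α δ ⟩
    α + δ + δ        ≡⟨ edge-22 ⟩
    root N 8 + δ     ≤⟨ +-monoˡ-≤ δ (root-mono N 8≤a) ⟩
    root N a + δ     ≤⟨ m≤m+n _ 3 ⟩
    root N a + δ + 3 ∎
    where
      open ≤-Reasoning
      e : ∀ a d → a + 0 + 2 * d ≡ a + d + d
      e = solve-∀

  edge-23 : ∀ {a} → 13 ≤ a → α + δ + 2 * δ ≤ root N a + δ + 3
  edge-23 {a} 13≤a = begin
    α + δ + 2 * δ      ≡⟨ e₁ α δ ⟩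
    α + 2 * δ + δ      ≤⟨ +-monoˡ-≤ δ roots-13 ⟩
    root N 13 + 3 + δ  ≤⟨ +-monoˡ-≤ δ (+-monoˡ-≤ 3 (root-mono N 13≤a)) ⟩
    root N a + 3 + δ   ≡⟨ e₂ (root N a) δ ⟩
    root N a + δ + 3   ∎
    where
      open ≤-Reasoning
      e₁ : ∀ a d → a + d + 2 * d ≡ a + 2 * d + d
      e₁ = solve-∀
      e₂ : ∀ r d → r + 3 + d ≡ r + d + 3
      e₂ = solve-∀

  edge-33 : ∀ {a} → 18 ≤ a → α + 2 * δ + 2 * δ ≤ root N a + δ + 3
  edge-33 {a} 18≤a = begin
    α + 2 * δ + 2 * δ  ≡⟨ e₁ α δ ⟩
    α + 3 * δ + δ      ≤⟨ +-monoˡ-≤ δ roots-18 ⟩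
    root N 18 + 3 + δ  ≤⟨ +-monoˡ-≤ δ (+-monoˡ-≤ 3 (root-mono N 18≤a)) ⟩
    root N a + 3 + δ   ≡⟨ e₂ (root N a) δ ⟩
    root N a + δ + 3   ∎
    where
      open ≤-Reasoning
      e₁ : ∀ a d → a + 2 * d + 2 * d ≡ a + 3 * d + d
      e₁ = solve-∀
      e₂ : ∀ r d → r + 3 + d ≡ r + d + 3
      e₂ = solve-∀

  -- The 3 absorbs the rounding of the floors. `Exact` has no such allowance: both sides are built
  -- from the same floors, which is why equality will hold at every scale.
  Charged Exact : (u-hub v-hub : Bool) (du dv : ℕ) → Set
  Charged b c du dv = α + weight b c du dv + weight c b dv du ≤ root N (du * du + dv * dv) + δ + 3
  Exact b c du dv = α + weight b c du dv + weight c b dv du ≡ root N (du * du + dv * dv) + δ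

  charged-swap : ∀ b c du dv → Charged c b dv du → Charged b c du dv
  charged-swap b c du dv le = ≤-trans
    (≤-reflexive (+-swap-right α (weight b c du dv) (weight c b dv du)))
    (≤-trans le (≤-reflexive (cong (λ z → root N z + δ + 3) (+-comm (dv * dv) (du * du)))))

  exact-swap : ∀ b c du dv → Exact c b dv du → Exact b c du dv
  exact-swap b c du dv eq = trans (+-swap-right α (weight b c du dv) (weight c b dv du))
    (trans eq (cong (λ z → root N z + δ) (+-comm (dv * dv) (du * du))))

  exact-hub : ∀ dv → 1 ≤ dv → dv ≤ 2 → Exact true false Δ dv
  exact-hub 1 _ _ = edge-hub-leaf
  exact-hub 2 _ _ = edge-hub-2
  exact-hub (suc (suc (suc _))) _ (s≤s (s≤s ()))

  charged-hub : ∀ dv → 1 ≤ dv → Charged true false Δ dv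
  charged-hub 1 _ = ≡⇒≤+3 edge-hub-leaf
  charged-hub 2 _ = ≡⇒≤+3 edge-hub-2
  charged-hub (suc (suc (suc d))) _ = ≤-trans (≡⇒≤+3 edge-hub-2)
    (+-monoˡ-≤ 3 (+-monoˡ-≤ δ (root-mono N (+-monoʳ-≤ (Δ * Δ) (≤-trans (m≤m+n 4 5) (9≤ d))))))

  exact-nonhub : ∀ du dv → 1 ≤ du → 1 ≤ dv → 2 ≤ du ⊎ 2 ≤ dv → du ≤ 2 → dv ≤ 2 →
                 Exact false false du dv
  exact-nonhub 1 1 _ _ (inj₁ (s≤s ()))
  exact-nonhub 1 1 _ _ (inj₂ (s≤s ()))
  exact-nonhub 1 2 _ _ _ _ _ = edge-12
  exact-nonhub 2 1 _ _ _ _ _ = exact-swap false false 2 1 edge-12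
  exact-nonhub 2 2 _ _ _ _ _ = edge-22
  exact-nonhub (suc (suc (suc _))) _ _ _ _ (s≤s (s≤s ()))
  exact-nonhub _ (suc (suc (suc _))) _ _ _ _ (s≤s (s≤s ()))

  -- An edge between two leaves has to be excluded, because there √5 exceeds √2 + δ.
  charged-nonhub : ∀ du dv → 1 ≤ du → 1 ≤ dv → 2 ≤ du ⊎ 2 ≤ dv → Charged false false du dv
  charged-nonhub 1 1 _ _ (inj₁ (s≤s ()))
  charged-nonhub 1 1 _ _ (inj₂ (s≤s ()))
  charged-nonhub 1 2 _ _ _ = ≡⇒≤+3 edge-12
  charged-nonhub 2 1 _ _ _ = charged-swap false false 2 1 (≡⇒≤+3 edge-12)
  charged-nonhub 2 2 _ _ _ = ≡⇒≤+3 edge-22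
  charged-nonhub 1 (suc (suc (suc d))) _ _ _ = edge-13
    (≤-trans (m≤m+n 8 1) (≤-trans (9≤ d) (m≤n+m _ 1)))
  charged-nonhub 2 (suc (suc (suc d))) _ _ _ = edge-23 (+-monoʳ-≤ 4 (9≤ d))
  charged-nonhub (suc (suc (suc d))) 1 _ _ _ =
    charged-swap false false (3 + d) 1 (charged-nonhub 1 (3 + d) (s≤s z≤n) (s≤s z≤n) (inj₂ (s≤s (s≤s z≤n))))
  charged-nonhub (suc (suc (suc d))) 2 _ _ _ =
    charged-swap false false (3 + d) 2 (charged-nonhub 2 (3 + d) (s≤s z≤n) (s≤s z≤n) (inj₂ (s≤s (s≤s z≤n))))
  charged-nonhub (suc (suc (suc d))) (suc (suc (suc d′))) _ _ _ = edge-33 (+-mono-≤ (9≤ d) (9≤ d′))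

-- Summing weights over a tree

<⇒≤ᵇ-true : ∀ {a b} → a < b → (suc a ≤ᵇ b) ≡ true
<⇒≤ᵇ-true {a} {b} p with suc a ≤ᵇ b in eq
... | true  = refl
... | false with () ← subst T eq (≤⇒≤ᵇ p)

≮⇒≤ᵇ-false : ∀ {a b} → ¬ a < b → (suc a ≤ᵇ b) ≡ false
≮⇒≤ᵇ-false {a} {b} p with suc a ≤ᵇ b in eq
... | false = refl
... | true  = contradiction (≤ᵇ⇒≤ (suc a) b (subst T (sym eq) tt)) p

module _ (G : Graph n) where

  private
    V = allFin n
    e : Fin n → Fin n → ℕ
    e i j = b2n (adj G i j)
    lt : Fin n → Fin n → Bool
    lt i j = suc (toℕ i) ≤ᵇ toℕ j

  dartSum : (Fin n → Fin n → ℕ) → ℕ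
  dartSum φ = ∑ V λ u → ∑ V λ v → e u v * φ u v

  private
    dart-mono : ∀ {u v x y} → (Adj G u v → x ≤ y) → e u v * x ≤ e u v * y
    dart-mono {u} {v} h with adj G u v
    ... | true  = *-monoʳ-≤ 1 (h refl)
    ... | false = z≤n

  dartSum-mono : ∀ {φ ψ} → (∀ u v → Adj G u v → φ u v ≤ ψ u v) → dartSum φ ≤ dartSum ψ
  dartSum-mono h = ∑-mono V λ {u} _ → ∑-mono V λ {v} _ → dart-mono (h u v)

  dartSum-cong : ∀ {φ ψ} → (∀ u v → Adj G u v → φ u v ≡ ψ u v) → dartSum φ ≡ dartSum ψ
  dartSum-cong h = ≤-antisym (dartSum-mono λ u v a → ≤-reflexive (h u v a))
                             (dartSum-mono λ u v a → ≤-reflexive (sym (h u v a)))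

  dartSum-+ : ∀ φ ψ → dartSum (λ u v → φ u v + ψ u v) ≡ dartSum φ + dartSum ψ
  dartSum-+ φ ψ = trans
    (∑-cong V λ {u} _ → trans (∑-cong V λ {v} _ → *-distribˡ-+ (e u v) (φ u v) (ψ u v))
                              (∑-distrib-+ V (λ v → e u v * φ u v) (λ v → e u v * ψ u v)))
    (∑-distrib-+ V (λ u → ∑ V λ v → e u v * φ u v) (λ u → ∑ V λ v → e u v * ψ u v))

  dartSum-const : ∀ c → dartSum (λ _ _ → c) ≡ c * ∑ V (deg G)
  dartSum-const c = trans
    (∑-cong V λ {u} _ → trans (∑-cong V λ {v} _ → *-comm (e u v) c) (∑-distrib-* V c (e u)))
    (∑-distrib-* V c (deg G))

  dartSum-flip : ∀ φ → dartSum (λ u v → φ v u) ≡ dartSum φ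
  dartSum-flip φ = trans (∑-swap V V λ u v → e u v * φ v u)
    (∑-cong V λ {v} _ → ∑-cong V λ {u} _ → cong (λ b → b2n b * φ v u) (Graph.sym G u v))

  -- Reversing darts leaves a dart sum unchanged, so both directions of φ contribute alike; the
  -- degree sum counts the darts.
  dartSum-symmetrised : ∀ c φ → dartSum (λ u v → c + φ u v + φ v u) ≡ c * ∑ V (deg G) + 2 * dartSum φ
  dartSum-symmetrised c φ = begin
    dartSum (λ u v → c + φ u v + φ v u)
      ≡⟨ dartSum-+ (λ u v → c + φ u v) (λ u v → φ v u) ⟩
    dartSum (λ u v → c + φ u v) + dartSum (λ u v → φ v u)
      ≡⟨ cong₂ _+_ (dartSum-+ (λ _ _ → c) φ) (dartSum-flip φ) ⟩
    dartSum (λ _ _ → c) + dartSum φ + dartSum φ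
      ≡⟨ cong (λ z → z + dartSum φ + dartSum φ) (dartSum-const c) ⟩
    c * ∑ V (deg G) + dartSum φ + dartSum φ
      ≡⟨ e′ (c * ∑ V (deg G)) (dartSum φ) ⟩
    c * ∑ V (deg G) + 2 * dartSum φ ∎
    where
      open ≡-Reasoning
      e′ : ∀ x y → x + y + y ≡ x + 2 * y
      e′ = solve-∀

  -- `edges` keeps a pair only in increasing order, so exactly one of the two orders of an edge
  -- survives; the diagonal vanishes because there are no loops.
  edge-pair : ∀ (φ : Fin n → Fin n → ℕ) → (∀ i j → φ i j ≡ φ j i) → ∀ i j →
    b2n (lt i j ∧ adj G i j) * φ i j + b2n (lt j i ∧ adj G j i) * φ j i ≡ e i j * φ i j
  edge-pair φ φ-sym i j rewrite Graph.sym G j i | φ-sym j i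
    with Fin.<-cmp i j
  ... | tri< i<j _ ¬j<i rewrite <⇒≤ᵇ-true i<j | ≮⇒≤ᵇ-false ¬j<i = +-identityʳ _
  ... | tri> ¬i<j _ j<i rewrite <⇒≤ᵇ-true j<i | ≮⇒≤ᵇ-false ¬i<j = refl
  ... | tri≈ ¬i<j refl _ rewrite ≮⇒≤ᵇ-false ¬i<j | irref G i = refl

  edge-weight : Fin n → Fin n → ℕ
  edge-weight u v = deg G u * deg G u + deg G v * deg G v

  private
    ∑-if : ∀ {A : Set} c (x : A) (f : A → ℕ) → ∑ (if c then [ x ] else []) f ≡ b2n c * f x
    ∑-if true  x f = refl
    ∑-if false x f = refl

  approx-SO : ∀ N → approx N (SO G) ≡
              ∑ V λ i → ∑ V λ j → b2n (lt i j ∧ adj G i j) * root N (edge-weight i j)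
  approx-SO N = begin
    approx N (SO G)    ≡⟨ ∑-map (edges G) (λ p → edge-weight (proj₁ p) (proj₂ p)) (root N) ⟩
    ∑ (edges G) F      ≡⟨ ∑-concatMap V (λ i → concatMap (pick i) V) F ⟩
    ∑ V (λ i → ∑ (concatMap (pick i) V) F)
                       ≡⟨ ∑-cong V (λ {i} _ → trans (∑-concatMap V (pick i) F)
                            (∑-cong V λ {j} _ → ∑-if (lt i j ∧ adj G i j) (i , j) F)) ⟩
    ∑ V (λ i → ∑ V λ j → b2n (lt i j ∧ adj G i j) * root N (edge-weight i j)) ∎
    where
      open ≡-Reasoning
      F : Fin n × Fin n → ℕ
      F (i , j) = root N (edge-weight i j)
      pick : Fin n → Fin n → List (Fin n × Fin n)
      pick i j = if lt i j ∧ adj G i j then [ (i , j) ] else []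

  2*approx-SO : ∀ N → 2 * approx N (SO G) ≡ dartSum (λ u v → root N (edge-weight u v))
  2*approx-SO N = begin
    2 * approx N (SO G)      ≡⟨ cong (2 *_) (approx-SO N) ⟩
    2 * S                    ≡⟨ cong (S +_) (+-identityʳ S) ⟩
    -- The second copy is transposed, so that each pair meets its reverse and `edge-pair` applies
    -- entrywise.
    S + S                    ≡⟨ cong (S +_) (∑-swap V V half) ⟩
    S + ∑ V (λ i → ∑ V λ j → half j i)
                             ≡⟨ ∑-distrib-+ V (λ i → ∑ V (half i)) (λ i → ∑ V λ j → half j i) ⟨
    ∑ V (λ i → ∑ V (half i) + ∑ V λ j → half j i)
                             ≡⟨ ∑-cong V (λ {i} _ → trans
                                  (sym (∑-distrib-+ V (half i) (λ j → half j i)))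
                                  (∑-cong V λ {j} _ → edge-pair φ φ-sym i j)) ⟩
    dartSum φ                ∎
    where
      open ≡-Reasoning
      φ half : Fin n → Fin n → ℕ
      φ u v = root N (edge-weight u v)
      half i j = b2n (lt i j ∧ adj G i j) * φ i j
      S = ∑ V λ i → ∑ V (half i)
      φ-sym : ∀ i j → φ i j ≡ φ j i
      φ-sym i j = cong (root N) (+-comm (deg G i * deg G i) (deg G j * deg G j))

-- Separating the hub from the other vertices

module Rest {n} (h : Fin n) where

  rest : List (Fin n)
  rest = filter (λ v → ¬? (v Fin.≟ h)) (allFin n)

  ∈-rest⇒≢ : ∀ {u} → u ∈ rest → u ≢ h
  ∈-rest⇒≢ u∈ = proj₂ (∈-filter⁻ (λ v → ¬? (v Fin.≟ h)) {xs = allFin n} u∈)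

  ≢⇒∈-rest : ∀ {u} → u ≢ h → u ∈ rest
  ≢⇒∈-rest {u} u≢h = ∈-filter⁺ (λ v → ¬? (v Fin.≟ h)) (∈-allFin u) u≢h

  split : allFin n ↭ h ∷ rest
  split = unique-↭ (allFin⁺ n)
    (∷-unique (λ h∈ → ∈-rest⇒≢ h∈ refl) (filter⁺ (λ v → ¬? (v Fin.≟ h)) (allFin⁺ n)))
    (λ {u} _ → case-hub u) (λ {u} _ → ∈-allFin u)
    where
      case-hub : ∀ u → u ∈ h ∷ rest
      case-hub u with u Fin.≟ h
      ... | yes u≡h = here u≡h
      ... | no u≢h  = there (≢⇒∈-rest u≢h)

  ∑-split : ∀ f → ∑ (allFin n) f ≡ f h + ∑ rest f
  ∑-split f = ∑-↭ f split

  length-rest : suc (length rest) ≡ n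
  length-rest = trans (sym (↭-length split)) (length-allFin n)

-- `k` is the number of vertices that are neither `h` nor adjacent to it.
module TreeSums {n} (G : Graph n) (tree : IsTree G) (h : Fin n) (Δ k : ℕ)
                (n≡ : n ≡ suc (Δ + k)) (deg-h : deg G h ≡ Δ) (3≤Δ : 3 ≤ Δ) where

  open Rest h public

  private
    V = allFin n
    e : Fin n → Fin n → ℕ
    e i j = b2n (adj G i j)

  inner leaf branching : Fin n → Bool
  inner v = 2 ≤ᵇ deg G v
  leaf v = not (inner v)
  branching v = 3 ≤ᵇ deg G v

  #inner-nbrs #leaf-nbrs #branching : ℕ
  #inner-nbrs = ∑ V λ v → b2n (adj G h v ∧ inner v)
  #leaf-nbrs = ∑ V λ v → b2n (adj G h v ∧ leaf v)
  #branching = ∑ rest λ v → b2n (branching v)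

  nbrs-split : #leaf-nbrs + #inner-nbrs ≡ Δ
  nbrs-split = trans (sym (∑-distrib-+ V (λ v → b2n (adj G h v ∧ leaf v)) (λ v → b2n (adj G h v ∧ inner v))))
    (trans (∑-cong V λ {v} _ → lem (adj G h v) (inner v)) deg-h)
    where
      lem : ∀ a b → b2n (a ∧ not b) + b2n (a ∧ b) ≡ b2n a
      lem true  true  = refl
      lem true  false = refl
      lem false _     = refl

  length-rest′ : length rest ≡ Δ + k
  length-rest′ = suc-injective (trans length-rest n≡)

  degree-sum : ∑ V (deg G) ≡ 2 * (Δ + k)
  degree-sum = +-cancelʳ-≡ 2 _ _ (trans (tree-degree-sum G tree h)
    (trans (cong (2 *_) n≡) (lem (Δ + k))))
    where
      lem : ∀ m → 2 * suc m ≡ 2 * m + 2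
      lem = solve-∀

  rest-degree-sum : ∑ rest (deg G) ≡ Δ + k + k
  rest-degree-sum = +-cancelˡ-≡ Δ _ _ (trans (sym (trans (∑-split (deg G)) (cong (_+ ∑ rest (deg G)) deg-h)))
    (trans degree-sum (lem Δ k)))
    where
      lem : ∀ a b → 2 * (a + b) ≡ a + (a + b + b)
      lem = solve-∀

  2≤deg-h : 2 ≤ deg G h
  2≤deg-h = ≤-trans (m≤m+n 2 1) (subst (3 ≤_) (sym deg-h) 3≤Δ)

  another : ∀ v → ∃[ w ] v ≢ w
  another v with v Fin.≟ h
  ... | no v≢h = h , v≢h
  ... | yes refl = nbr (length rest) refl
    where
      nbr : ∀ m → m ≡ length rest → ∃[ w ] h ≢ w
      nbr _ eq with rest in r
      ... | [] = contradiction (trans (sym (cong length r)) length-rest′)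
                   (<⇒≢ (≤-trans (≤-trans (s≤s z≤n) 3≤Δ) (m≤m+n Δ k)))
      ... | w ∷ _ = w , λ h≡w → ∈-rest⇒≢ (subst (w ∈_) (sym r) (here refl)) (sym h≡w)

  pos : ∀ v → 1 ≤ deg G v
  pos v = 1≤deg G (proj₁ tree) (proj₂ (another v))

  2≤-end : ∀ {u v} → Adj G u v → 2 ≤ deg G u ⊎ 2 ≤ deg G v
  2≤-end {u} {v} a with 2 ≤? deg G u | 2 ≤? deg G v
  ... | yes p | _ = inj₁ p
  ... | _ | yes q = inj₂ q
  ... | no p | no q = no-adjacent-leaves G (proj₁ tree) 2≤deg-h a (s≤s⁻¹ (≰⇒> p)) (s≤s⁻¹ (≰⇒> q))

  module AtScale (N : ℕ) where

    open Weights Δ N 3≤Δ public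

    is-hub : Fin n → Bool
    is-hub v = does (v Fin.≟ h)

    w : Fin n → Fin n → ℕ
    w u v = weight (is-hub u) (is-hub v) (deg G u) (deg G v)

    W : Fin n → ℕ
    W u = ∑ V λ v → e u v * w u v

    private
      hub-true : is-hub h ≡ true
      hub-true = dec-true (h Fin.≟ h) refl

      hub-false : ∀ {v} → v ≢ h → is-hub v ≡ false
      hub-false {v} = dec-false (v Fin.≟ h)

      m = Δ + k

    w-charged : ∀ u v → Adj G u v → α + w u v + w v u ≤ root N (edge-weight G u v) + (δ + 3)
    w-charged u v a = ≤-trans (go (u Fin.≟ h) (v Fin.≟ h)) (≤-reflexive (+-assoc _ δ 3))
      where
        -- With the two decisions as arguments, the hub flags reduce in each case.
        go : ∀ (du : _) (dv : _) → Charged (does du) (does dv) (deg G u) (deg G v)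
        go (yes refl) (yes refl) = contradiction refl (adj⇒≢ G a)
        go (yes refl) (no _) = subst (λ d → Charged true false d (deg G v)) (sym deg-h)
          (charged-hub (deg G v) (pos v))
        go (no _) (yes refl) = charged-swap false true (deg G u) (deg G v)
          (subst (λ d → Charged true false d (deg G u)) (sym deg-h) (charged-hub (deg G u) (pos u)))
        go (no _) (no _) = charged-nonhub (deg G u) (deg G v) (pos u) (pos v) (2≤-end a)

    w-exact : (∀ {u} → u ≢ h → deg G u ≤ 2) → ∀ u v → Adj G u v →
              α + w u v + w v u ≡ root N (edge-weight G u v) + δ
    w-exact small u v a = go (u Fin.≟ h) (v Fin.≟ h)
      where
        go : ∀ (du : _) (dv : _) → Exact (does du) (does dv) (deg G u) (deg G v)
        go (yes refl) (yes refl) = contradiction refl (adj⇒≢ G a)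
        go (yes refl) (no v≢h) = subst (λ d → Exact true false d (deg G v)) (sym deg-h)
          (exact-hub (deg G v) (pos v) (small v≢h))
        go (no u≢h) (yes refl) = exact-swap false true (deg G u) (deg G v)
          (subst (λ d → Exact true false d (deg G u)) (sym deg-h)
            (exact-hub (deg G u) (pos u) (small u≢h)))
        go (no u≢h) (no v≢h) =
          exact-nonhub (deg G u) (deg G v) (pos u) (pos v) (2≤-end a) (small u≢h) (small v≢h)

    W-hub : W h ≡ #leaf-nbrs * κ + #inner-nbrs * π
    W-hub = begin
      W h
        ≡⟨ ∑-cong V (λ {v} _ → lem v) ⟩
      ∑ V (λ v → κ * b2n (adj G h v ∧ leaf v) + π * b2n (adj G h v ∧ inner v))
        ≡⟨ ∑-distrib-+ V (λ v → κ * b2n (adj G h v ∧ leaf v)) (λ v → π * b2n (adj G h v ∧ inner v)) ⟩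
      ∑ V (λ v → κ * b2n (adj G h v ∧ leaf v)) + ∑ V (λ v → π * b2n (adj G h v ∧ inner v))
        ≡⟨ cong₂ _+_ (∑-distrib-* V κ (λ v → b2n (adj G h v ∧ leaf v)))
                     (∑-distrib-* V π (λ v → b2n (adj G h v ∧ inner v))) ⟩
      κ * #leaf-nbrs + π * #inner-nbrs
        ≡⟨ cong₂ _+_ (*-comm κ #leaf-nbrs) (*-comm π #inner-nbrs) ⟩
      #leaf-nbrs * κ + #inner-nbrs * π ∎
      where
        open ≡-Reasoning
        lem : ∀ v → e h v * w h v ≡ κ * b2n (adj G h v ∧ leaf v) + π * b2n (adj G h v ∧ inner v)
        lem v rewrite hub-true with adj G h v | inner v
        ... | false | _ rewrite *-zeroʳ κ | *-zeroʳ π = refl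
        ... | true | true rewrite *-zeroʳ κ | *-identityʳ π = +-identityʳ π
        ... | true | false rewrite *-zeroʳ π | *-identityʳ κ = refl

    private
      bump : Fin n → Fin n → ℕ
      bump u v = e u v * b2n (is-hub v)

      bump≤1 : ∀ u → ∑ V (bump u) ≤ 1
      bump≤1 u = ≤-trans (∑-mono V λ {v} _ → e*≤ (adj G u v) (b2n (is-hub v)))
        (∑-b2n-≤ is-hub {ys = [ h ]} (allFin⁺ n) λ {v} _ → eq v)
        where
          e*≤ : ∀ b x → b2n b * x ≤ x
          e*≤ true  x = ≤-reflexive (*-identityˡ x)
          e*≤ false x = z≤n
          eq : ∀ v → is-hub v ≡ true → v ∈ [ h ]
          eq v _ with v Fin.≟ h
          eq v _  | yes p = here p

      W-const : ∀ u c → (∀ v → w u v ≡ c) → W u ≡ c * deg G u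
      W-const u c h = trans (∑-cong V λ {v} _ → trans (cong (e u v *_) (h v)) (*-comm (e u v) c))
                            (∑-distrib-* V c (e u))

    -- The value 2δ(d - 1), written without subtraction: the weights 0 and 2δ for d = 1 and d = 2
    -- meet it exactly.
    W-small : ∀ u → u ≢ h → deg G u ≤ 2 → W u + 2 * δ ≡ 2 * δ * deg G u
    W-small u u≢h d≤2 = go (deg G u) refl
      where
        go : ∀ d → deg G u ≡ d → W u + 2 * δ ≡ 2 * δ * deg G u
        go 0 eq = contradiction (subst (1 ≤_) eq (pos u)) λ ()
        go 1 eq = trans (cong (_+ 2 * δ) (W-const u 0 λ v →
            trans (cong (λ b → weight b (is-hub v) (deg G u) (deg G v)) (hub-false u≢h))
                  (cong (λ d → weight false (is-hub v) d (deg G v)) eq)))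
          (sym (trans (cong (2 * δ *_) eq) (*-identityʳ (2 * δ))))
        go 2 eq = trans (cong (_+ 2 * δ) (W-const u δ λ v →
            trans (cong (λ b → weight b (is-hub v) (deg G u) (deg G v)) (hub-false u≢h))
                  (cong (λ d → weight false (is-hub v) d (deg G v)) eq)))
          (trans (cong (λ d → δ * d + 2 * δ) eq) (trans (lem δ) (sym (cong (2 * δ *_) eq))))
          where
            lem : ∀ d → d * 2 + 2 * d ≡ 2 * d * 2
            lem = solve-∀
        go (suc (suc (suc _))) eq = contradiction (subst (_≤ 2) eq d≤2) λ { (s≤s (s≤s ())) }

    -- If every dart from `u` carried 2δ, the total would be 2δ times the degree; only the dart to
    -- the hub, counted by `bump`, falls short, by δ.
    W-branching : ∀ u → u ≢ h → 3 ≤ deg G u → 2 * δ * deg G u ≤ W u + δ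
    W-branching u u≢h 3≤d = begin
      2 * δ * deg G u                      ≡⟨ ∑-distrib-* V (2 * δ) (e u) ⟨
      ∑ V (λ v → 2 * δ * e u v)            ≡⟨ ∑-cong V (λ {v} _ → pointwise v) ⟩
      ∑ V (λ v → e u v * w u v + δ * bump u v)
                                           ≡⟨ ∑-distrib-+ V (λ v → e u v * w u v) (λ v → δ * bump u v) ⟩
      W u + ∑ V (λ v → δ * bump u v)       ≡⟨ cong (W u +_) (∑-distrib-* V δ (bump u)) ⟩
      W u + δ * ∑ V (bump u)               ≤⟨ +-monoʳ-≤ (W u) (*-monoʳ-≤ δ (bump≤1 u)) ⟩
      W u + δ * 1                          ≡⟨ cong (W u +_) (*-identityʳ δ) ⟩
      W u + δ                              ∎
      where
        open ≤-Reasoning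
        balance : ∀ c d dv → 3 ≤ d → weight false c d dv + δ * b2n c ≡ 2 * δ
        balance true (suc (suc (suc d))) dv _ = cong (δ +_) (*-comm δ 1)
        balance false (suc (suc (suc d))) dv _ = trans (cong (2 * δ +_) (*-zeroʳ δ)) (+-identityʳ (2 * δ))
        balance _ 1 _ (s≤s ())
        balance _ 2 _ (s≤s (s≤s ()))
        lem : ∀ a x y z → a * x + y * (a * z) ≡ a * (x + y * z)
        lem = solve-∀
        pointwise : ∀ v → 2 * δ * e u v ≡ e u v * w u v + δ * bump u v
        pointwise v rewrite hub-false u≢h = sym (trans
          (lem (e u v) (weight false (is-hub v) (deg G u) (deg G v)) δ (b2n (is-hub v)))
          (trans (cong (e u v *_) (balance (is-hub v) (deg G u) (deg G v) 3≤d)) (*-comm (e u v) (2 * δ))))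

    W-nonhub : ∀ {u} → u ≢ h → 2 * δ * deg G u + δ * b2n (branching u) ≤ W u + 2 * δ
    W-nonhub {u} u≢h with deg G u ≤? 2
    ... | yes d≤2 rewrite ≮⇒≤ᵇ-false (≤⇒≯ d≤2) | *-zeroʳ δ | +-identityʳ (2 * δ * deg G u) =
      ≤-reflexive (sym (W-small u u≢h d≤2))
    ... | no d≰2 rewrite <⇒≤ᵇ-true (≰⇒> d≰2) = ≤-trans
      (+-mono-≤ (W-branching u u≢h (≰⇒> d≰2)) (≤-reflexive (*-identityʳ δ)))
      (≤-reflexive (lem (W u) δ))
      where
        lem : ∀ x d → x + d + d ≡ x + 2 * d
        lem = solve-∀

    -- The edge inequalities `w-charged` are summed over all darts and the left side is regrouped by
    -- vertices. As `m` is also the number of edges, the rounding allowance is 3 per edge.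
    SO-bound : α * m + (#leaf-nbrs * κ + #inner-nbrs * π) + 2 * δ * k + δ * #branching
               ≤ approx N (SO G) + δ * m + 3 * m
    -- The term added to both sides stands for the 2δ subtracted at each of the `m` vertices other
    -- than `h`; the factor 2 counts both darts of an edge.
    SO-bound = *-cancelˡ-≤ 2 (+-cancelʳ-≤ (2 * (2 * δ * m)) _ _ (begin
      2 * (α * m + H + 2 * δ * k + δ * #branching) + 2 * (2 * δ * m)
        ≡⟨ e₁ α m H δ k #branching ⟩
      α * (2 * m) + 2 * (H + (2 * δ * (m + k) + δ * #branching))
        ≤⟨ +-monoʳ-≤ (α * (2 * m)) (*-monoʳ-≤ 2 (+-monoʳ-≤ H rest-W)) ⟩
      α * (2 * m) + 2 * (H + (∑ rest W + 2 * δ * m))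
        ≡⟨ e₂ (α * (2 * m)) H (∑ rest W) (2 * δ * m) ⟩
      α * (2 * m) + 2 * (H + ∑ rest W) + 2 * (2 * δ * m)
        ≡⟨ cong (_+ 2 * (2 * δ * m)) lhs ⟨
      dartSum G (λ u v → α + w u v + w v u) + 2 * (2 * δ * m)
        ≤⟨ +-monoˡ-≤ (2 * (2 * δ * m)) (dartSum-mono G w-charged) ⟩
      dartSum G (λ u v → root N (edge-weight G u v) + (δ + 3)) + 2 * (2 * δ * m)
        ≡⟨ cong (_+ 2 * (2 * δ * m)) rhs ⟩
      2 * approx N (SO G) + (δ + 3) * (2 * m) + 2 * (2 * δ * m)
        ≡⟨ e₃ (approx N (SO G)) δ m (2 * (2 * δ * m)) ⟩
      2 * (approx N (SO G) + δ * m + 3 * m) + 2 * (2 * δ * m) ∎))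
      where
        open ≤-Reasoning
        H = #leaf-nbrs * κ + #inner-nbrs * π
        rest-W : 2 * δ * (m + k) + δ * #branching ≤ ∑ rest W + 2 * δ * m
        rest-W = begin
          2 * δ * (m + k) + δ * #branching
            ≡⟨ cong (λ z → 2 * δ * z + δ * #branching) rest-degree-sum ⟨
          2 * δ * ∑ rest (deg G) + δ * #branching
            ≡⟨ cong₂ _+_ (∑-distrib-* rest (2 * δ) (deg G)) (∑-distrib-* rest δ (λ v → b2n (branching v))) ⟨
          ∑ rest (λ u → 2 * δ * deg G u) + ∑ rest (λ u → δ * b2n (branching u))
            ≡⟨ ∑-distrib-+ rest (λ u → 2 * δ * deg G u) (λ u → δ * b2n (branching u)) ⟨
          ∑ rest (λ u → 2 * δ * deg G u + δ * b2n (branching u))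
            ≤⟨ ∑-mono rest (λ u∈ → W-nonhub (∈-rest⇒≢ u∈)) ⟩
          ∑ rest (λ u → W u + 2 * δ)
            ≡⟨ ∑-distrib-+ rest W (λ _ → 2 * δ) ⟩
          ∑ rest W + ∑ rest (λ _ → 2 * δ)
            ≡⟨ cong (∑ rest W +_) (trans (∑-const rest (2 * δ)) (trans (cong (_* (2 * δ)) length-rest′) (*-comm m (2 * δ)))) ⟩
          ∑ rest W + 2 * δ * m ∎
        lhs : dartSum G (λ u v → α + w u v + w v u) ≡ α * (2 * m) + 2 * (H + ∑ rest W)
        lhs = trans (dartSum-symmetrised G α w)
          (cong₂ (λ x y → α * x + 2 * y) degree-sum (trans (∑-split W) (cong (_+ ∑ rest W) W-hub)))
        rhs : dartSum G (λ u v → root N (edge-weight G u v) + (δ + 3)) ≡ 2 * approx N (SO G) + (δ + 3) * (2 * m)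
        rhs = trans (dartSum-+ G (λ u v → root N (edge-weight G u v)) (λ _ _ → δ + 3))
          (cong₂ _+_ (sym (2*approx-SO G N)) (trans (dartSum-const G (δ + 3)) (cong ((δ + 3) *_) degree-sum)))
        e₁ : ∀ a m H d k b → 2 * (a * m + H + 2 * d * k + d * b) + 2 * (2 * d * m)
                           ≡ a * (2 * m) + 2 * (H + (2 * d * (m + k) + d * b))
        e₁ = solve-∀
        e₂ : ∀ a H r x → a + 2 * (H + (r + x)) ≡ a + 2 * (H + r) + 2 * x
        e₂ = solve-∀
        e₃ : ∀ s d m x → 2 * s + (d + 3) * (2 * m) + x ≡ 2 * (s + d * m + 3 * m) + x
        e₃ = solve-∀

    -- Without a second branch vertex every estimate behind `SO-bound` becomes an identity, rounding
    -- included.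
    SO-exact : (∀ {u} → u ≢ h → deg G u ≤ 2) →
               α * m + (#leaf-nbrs * κ + #inner-nbrs * π) + 2 * δ * k ≡ approx N (SO G) + δ * m
    SO-exact small = *-cancelˡ-≡ _ _ 2 (+-cancelʳ-≡ (2 * (2 * δ * m)) _ _ (begin
      2 * (α * m + H + 2 * δ * k) + 2 * (2 * δ * m)
        ≡⟨ e₁ α m H δ k ⟩
      α * (2 * m) + 2 * (H + (2 * δ * (m + k)))
        ≡⟨ cong (λ z → α * (2 * m) + 2 * (H + z)) rest-W ⟩
      α * (2 * m) + 2 * (H + (∑ rest W + 2 * δ * m))
        ≡⟨ e₂ (α * (2 * m)) H (∑ rest W) (2 * δ * m) ⟩
      α * (2 * m) + 2 * (H + ∑ rest W) + 2 * (2 * δ * m)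
        ≡⟨ cong (_+ 2 * (2 * δ * m)) lhs ⟨
      dartSum G (λ u v → α + w u v + w v u) + 2 * (2 * δ * m)
        ≡⟨ cong (_+ 2 * (2 * δ * m)) (dartSum-cong G (w-exact small)) ⟩
      dartSum G (λ u v → root N (edge-weight G u v) + δ) + 2 * (2 * δ * m)
        ≡⟨ cong (_+ 2 * (2 * δ * m)) rhs ⟩
      2 * approx N (SO G) + δ * (2 * m) + 2 * (2 * δ * m)
        ≡⟨ e₃ (approx N (SO G)) δ m (2 * (2 * δ * m)) ⟩
      2 * (approx N (SO G) + δ * m) + 2 * (2 * δ * m) ∎))
      where
        open ≡-Reasoning
        H = #leaf-nbrs * κ + #inner-nbrs * π
        rest-W : 2 * δ * (m + k) ≡ ∑ rest W + 2 * δ * m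
        rest-W = begin
          2 * δ * (m + k)
            ≡⟨ cong (2 * δ *_) rest-degree-sum ⟨
          2 * δ * ∑ rest (deg G)
            ≡⟨ ∑-distrib-* rest (2 * δ) (deg G) ⟨
          ∑ rest (λ u → 2 * δ * deg G u)
            ≡⟨ ∑-cong rest (λ {u} u∈ → W-small u (∈-rest⇒≢ u∈) (small (∈-rest⇒≢ u∈))) ⟨
          ∑ rest (λ u → W u + 2 * δ)
            ≡⟨ ∑-distrib-+ rest W (λ _ → 2 * δ) ⟩
          ∑ rest W + ∑ rest (λ _ → 2 * δ)
            ≡⟨ cong (∑ rest W +_) (trans (∑-const rest (2 * δ)) (trans (cong (_* (2 * δ)) length-rest′) (*-comm m (2 * δ)))) ⟩
          ∑ rest W + 2 * δ * m ∎
        lhs : dartSum G (λ u v → α + w u v + w v u) ≡ α * (2 * m) + 2 * (H + ∑ rest W)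
        lhs = trans (dartSum-symmetrised G α w)
          (cong₂ (λ x y → α * x + 2 * y) degree-sum (trans (∑-split W) (cong (_+ ∑ rest W) W-hub)))
        rhs : dartSum G (λ u v → root N (edge-weight G u v) + δ) ≡ 2 * approx N (SO G) + δ * (2 * m)
        rhs = trans (dartSum-+ G (λ u v → root N (edge-weight G u v)) (λ _ _ → δ))
          (cong₂ _+_ (sym (2*approx-SO G N)) (trans (dartSum-const G δ) (cong (δ *_) degree-sum)))
        e₁ : ∀ a m H d k → 2 * (a * m + H + 2 * d * k) + 2 * (2 * d * m)
                           ≡ a * (2 * m) + 2 * (H + (2 * d * (m + k)))
        e₁ = solve-∀
        e₂ : ∀ a H r x → a + 2 * (H + (r + x)) ≡ a + 2 * (H + r) + 2 * x
        e₂ = solve-∀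
        e₃ : ∀ s d m x → 2 * s + d * (2 * m) + x ≡ 2 * (s + d * m) + x
        e₃ = solve-∀

-- Extremal trees

∧-trueʳ : ∀ {a b} → a ∧ b ≡ true → b ≡ true
∧-trueʳ {true} p = p

≡ᵇ-true⇒≡ : ∀ {a b} → (a ≡ᵇ b) ≡ true → a ≡ b
≡ᵇ-true⇒≡ {a} {b} p = ≡ᵇ⇒≡ a b (subst T (sym p) tt)

≡ᵇ-refl : ∀ a → (a ≡ᵇ a) ≡ true
≡ᵇ-refl zero    = refl
≡ᵇ-refl (suc a) = ≡ᵇ-refl a

≢⇒≡ᵇ-false : ∀ {a b} → a ≢ b → (a ≡ᵇ b) ≡ false
≢⇒≡ᵇ-false {a} {b} a≢b with a ≡ᵇ b in eq
... | false = refl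
... | true  = contradiction (≡ᵇ-true⇒≡ eq) a≢b

∨-true⇒ : ∀ {a b} → a ∨ b ≡ true → a ≡ true ⊎ b ≡ true
∨-true⇒ {true}  _ = inj₁ refl
∨-true⇒ {false} p = inj₂ p

-- A missed value together with the image would give n + 1 distinct elements.
Fin-injective⇒surjective : ∀ {f : Fin n → Fin n} → Injective _≡_ _≡_ f → ∀ y → ∃[ x ] f x ≡ y
Fin-injective⇒surjective {n} {f} inj y with Fin.any? (λ x → f x Fin.≟ y)
... | yes p = p
... | no ¬p = contradiction
  (≤-trans (s≤s (≤-reflexive (sym (trans (length-map f (allFin n)) (length-allFin n)))))
    (unique⇒length≤n (∷-unique y∉ (Unique.map⁺ inj (allFin⁺ n))))) 1+n≰n
  where
    y∉ : y ∉ map f (allFin n)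
    y∉ y∈ = let x , _ , eq = ∈-map⁻ f y∈ in ¬p (x , sym eq)

-- The equation that `SO-exact` gives for a tree whose only branch vertex is the hub, with `ℓ` leaf
-- and `a` inner neighbours. Both bounds of the theorem have this form.
HasValue : (Δ k : ℕ) → 3 ≤ Δ → RootSum → (ℓ a : ℕ) → Set
HasValue Δ k 3≤Δ xs ℓ a = ∀ N → let open Weights Δ N 3≤Δ in
  approx N xs + δ * (Δ + k) ≡ α * (Δ + k) + (ℓ * κ + a * π) + 2 * δ * k

module Extremal {n} (G : Graph n) (tree : IsTree G) (h : Fin n) (Δ k : ℕ)
                (n≡ : n ≡ suc (Δ + k)) (deg-h : deg G h ≡ Δ) (3≤Δ : 3 ≤ Δ) where

  open TreeSums G tree h Δ k n≡ deg-h 3≤Δ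

  private
    V = allFin n
    m = Δ + k

  NoOtherBranch : Set
  NoOtherBranch = ∀ {u} → u ≢ h → deg G u ≤ 2

  no-branching : #branching ≡ 0 → NoOtherBranch
  no-branching eq {u} u≢h with deg G u ≤? 2
  ... | yes p = p
  ... | no ¬p = contradiction
    (subst (1 ≤_) eq (≤-trans (≤-reflexive (cong b2n (sym (<⇒≤ᵇ-true (≰⇒> ¬p)))))
      (∈⇒≤∑ (λ v → b2n (branching v)) (≢⇒∈-rest u≢h)))) λ ()

  -- xs is the value of the lower bound for ℓ leaf neighbours of h; each of the e leaf
  -- neighbours in excess of ℓ costs κ − π.
  module Bound (xs : RootSum) (ℓ a e : ℕ) (ℓ+e : ℓ + e ≡ #leaf-nbrs) (a≡ : #inner-nbrs + e ≡ a)
               (value : HasValue Δ k 3≤Δ xs ℓ a) where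

    -- Every excess leaf neighbour gains at least `N`/20 by `π-κ-gap`, and every further branch
    -- vertex gains δ, at least 11`N`/20. The constant collects the rounding errors of `SO-bound`
    -- and of these two estimates.
    slack : ∀ N → 20 * approx N xs + (e + #branching) * N
                  ≤ 20 * approx N (SO G) + (60 * m + 40 * e + 20 * #branching)
    slack N = +-cancelʳ-≤ (20 * (δ * m) + 20 * (e * κ) + 20 * (δ * b)) _ _ (begin
      20 * X + (e + b) * N + (20 * (δ * m) + 20 * (e * κ) + 20 * (δ * b))
        ≡⟨ e₁ X (δ * m) e b N κ δ ⟩
      20 * (X + δ * m) + 20 * (e * κ) + 20 * (δ * b) + e * N + b * N
        ≡⟨ cong (λ z → 20 * z + 20 * (e * κ) + 20 * (δ * b) + e * N + b * N) value′ ⟩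
      20 * (α * m + (ℓ * κ + (#inner-nbrs + e) * π) + 2 * δ * k) + 20 * (e * κ) + 20 * (δ * b) + e * N + b * N
        ≡⟨ e₂ (α * m) ℓ κ #inner-nbrs e π (2 * δ * k) (δ * b) N (b * N) ⟩
      20 * (α * m + ((ℓ + e) * κ + #inner-nbrs * π) + 2 * δ * k + δ * b) + e * (20 * π + N) + b * N
        ≡⟨ cong (λ z → 20 * (α * m + (z * κ + #inner-nbrs * π) + 2 * δ * k + δ * b) + e * (20 * π + N) + b * N) ℓ+e ⟩
      20 * (α * m + (#leaf-nbrs * κ + #inner-nbrs * π) + 2 * δ * k + δ * b) + e * (20 * π + N) + b * N
        ≤⟨ +-mono-≤ (+-mono-≤ (*-monoʳ-≤ 20 SO-bound) (*-monoʳ-≤ e π-κ-gap))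
                    (*-monoʳ-≤ b (≤-trans (m≤m+n N (10 * N)) 11N≤20δ)) ⟩
      20 * (Y + δ * m + 3 * m) + e * (20 * κ + 40) + b * (20 * δ + 20)
        ≡⟨ e₃ Y (δ * m) m e κ b δ ⟩
      20 * Y + (60 * m + 40 * e + 20 * b) + (20 * (δ * m) + 20 * (e * κ) + 20 * (δ * b)) ∎)
      where
        open ≤-Reasoning
        open AtScale N
        X = approx N xs
        Y = approx N (SO G)
        b = #branching
        value′ : X + δ * m ≡ α * m + (ℓ * κ + (#inner-nbrs + e) * π) + 2 * δ * k
        value′ = trans (value N) (cong (λ z → α * m + (ℓ * κ + z * π) + 2 * δ * k) (sym a≡))
        e₁ : ∀ X x e b N κ d → 20 * X + (e + b) * N + (20 * x + 20 * (e * κ) + 20 * (d * b))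
             ≡ 20 * (X + x) + 20 * (e * κ) + 20 * (d * b) + e * N + b * N
        e₁ = solve-∀
        e₂ : ∀ x l κ i e π y z N w →
             20 * (x + (l * κ + (i + e) * π) + y) + 20 * (e * κ) + 20 * z + e * N + w
             ≡ 20 * (x + ((l + e) * κ + i * π) + y + z) + e * (20 * π + N) + w
        e₂ = solve-∀
        e₃ : ∀ Y x m e κ b d → 20 * (Y + x + 3 * m) + e * (20 * κ + 40) + b * (20 * d + 20)
             ≡ 20 * Y + (60 * m + 40 * e + 20 * b) + (20 * x + 20 * (e * κ) + 20 * (d * b))
        e₃ = solve-∀

    lower-bound : xs ≤√ SO G
    -- `≤√-intro` takes the predecessor of the multiplier 20; the gap term is dropped.
    lower-bound = ≤√-intro xs (SO G) 19 _ λ N → ≤-trans (m≤m+n _ _) (slack N)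

    equality⇒ : SO G ≤√ xs → e ≡ 0 × NoOtherBranch
    equality⇒ le = m+n≡0⇒m≡0 e gap , no-branching (m+n≡0⇒n≡0 e gap)
      where
        gap : e + #branching ≡ 0
        gap = ≤√-no-gap xs (SO G) 20 _ _ slack le

    -- The approximations agree at every scale, not merely up to a bounded error.
    ⇒equality : e ≡ 0 → NoOtherBranch → SO G ≈√ xs
    ⇒equality e≡0 small = (λ N → ≤-trans (≤-reflexive (same N)) (m≤m+n _ _)) ,
                          (λ N → ≤-trans (≤-reflexive (sym (same N))) (m≤m+n _ _))
      where
        ℓ≡ : #leaf-nbrs ≡ ℓ
        ℓ≡ = trans (sym ℓ+e) (trans (cong (ℓ +_) e≡0) (+-identityʳ ℓ))
        inner≡ : #inner-nbrs ≡ a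
        inner≡ = trans (sym (trans (cong (#inner-nbrs +_) e≡0) (+-identityʳ _))) a≡
        same : ∀ N → approx N (SO G) ≡ approx N xs
        same N = +-cancelʳ-≡ (δ * m) _ _ (trans (sym (SO-exact small)) (trans
          (cong₂ (λ x y → α * m + (x * κ + y * π) + 2 * δ * k) ℓ≡ inner≡) (sym (value N))))
          where open AtScale N

  -- Counting degrees from below

  min-deg : Fin n → ℕ
  min-deg u = suc (b2n (adj G h u ∧ inner u))

  min-deg≤deg : ∀ u → min-deg u ≤ deg G u
  min-deg≤deg u with adj G h u ∧ inner u in eq
  ... | false = pos u
  ... | true  = ≤ᵇ⇒≤ 2 _ (subst T (sym (∧-trueʳ {adj G h u} eq)) tt)

  ∑-min-deg : ∑ rest min-deg ≡ m + #inner-nbrs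
  ∑-min-deg = begin
    ∑ rest min-deg
      ≡⟨ ∑-distrib-+ rest (λ _ → 1) (λ u → b2n (adj G h u ∧ inner u)) ⟩
    ∑ rest (λ _ → 1) + ∑ rest (λ u → b2n (adj G h u ∧ inner u))
      ≡⟨ cong₂ _+_ (trans (∑-const rest 1) (trans (*-identityʳ _) length-rest′)) (sym rest≡) ⟩
    m + #inner-nbrs ∎
    where
      open ≡-Reasoning
      rest≡ : #inner-nbrs ≡ ∑ rest (λ u → b2n (adj G h u ∧ inner u))
      rest≡ = trans (∑-split (λ u → b2n (adj G h u ∧ inner u)))
        (cong (λ z → b2n (z ∧ inner h) + ∑ rest (λ u → b2n (adj G h u ∧ inner u))) (irref G h))

  -- The degrees other than that of `h` sum to `m + k`, while every vertex needs at least 1 and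
  -- every inner neighbour of `h` one more.
  #inner-nbrs≤k : #inner-nbrs ≤ k
  #inner-nbrs≤k = +-cancelˡ-≤ m _ _ (begin
    m + #inner-nbrs  ≡⟨ ∑-min-deg ⟨
    ∑ rest min-deg   ≤⟨ ∑-mono rest (λ {u} _ → min-deg≤deg u) ⟩
    ∑ rest (deg G)   ≡⟨ rest-degree-sum ⟩
    m + k            ∎)
    where open ≤-Reasoning

  -- In the extreme case the degree sum leaves nothing to spare, so each degree attains its minimum.
  #inner-nbrs≡k⇒min-deg : #inner-nbrs ≡ k → ∀ {u} → u ≢ h → deg G u ≡ min-deg u
  #inner-nbrs≡k⇒min-deg eq u≢h = sym (∑-rigid rest (λ {u} _ → min-deg≤deg u)
    (≤-reflexive (trans rest-degree-sum (trans (cong (m +_) (sym eq)) (sym ∑-min-deg)))) (≢⇒∈-rest u≢h))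

  min-deg⇒#inner-nbrs≡k : (∀ {u} → u ≢ h → deg G u ≤ min-deg u) → #inner-nbrs ≡ k
  min-deg⇒#inner-nbrs≡k h≤ = ≤-antisym #inner-nbrs≤k (+-cancelˡ-≤ m _ _ (begin
    m + k            ≡⟨ rest-degree-sum ⟨
    ∑ rest (deg G)   ≤⟨ ∑-mono rest (λ u∈ → h≤ (∈-rest⇒≢ u∈)) ⟩
    ∑ rest min-deg   ≡⟨ ∑-min-deg ⟩
    m + #inner-nbrs  ∎))
    where open ≤-Reasoning

  b2n≤1 : ∀ b → b2n b ≤ 1
  b2n≤1 true  = ≤-refl
  b2n≤1 false = z≤n

  tight⇒no-other-branch : #inner-nbrs ≡ k → NoOtherBranch
  tight⇒no-other-branch eq {u} u≢h = subst (_≤ 2) (sym (#inner-nbrs≡k⇒min-deg eq u≢h)) (s≤s (b2n≤1 _))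

  -- Spiders with long legs

  no-leaf-nbrs⇔ : (#leaf-nbrs ≡ 0 × NoOtherBranch) ⇔ SpiderLongLegs G Δ
  no-leaf-nbrs⇔ = mk⇔ to from
    where
      3≤deg-h : 3 ≤ deg G h
      3≤deg-h = subst (3 ≤_) (sym deg-h) 3≤Δ

      to : #leaf-nbrs ≡ 0 × NoOtherBranch → SpiderLongLegs G Δ
      to (ℓ≡0 , small) = (tree , λ u v 3≤u 3≤v → trans (is-h 3≤u) (sym (is-h 3≤v))) ,
                         h , deg-h , long
        where
          is-h : ∀ {u} → 3 ≤ deg G u → u ≡ h
          is-h {u} 3≤u with u Fin.≟ h
          ... | yes p = p
          ... | no ¬p = contradiction (≤-trans 3≤u (small ¬p)) 1+n≰n
          long : ∀ v → Adj G h v → 2 ≤ deg G v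
          long v a with inner v in eq
          ... | true = ≤ᵇ⇒≤ 2 _ (subst T (sym eq) tt)
          ... | false = contradiction (subst (1 ≤_) ℓ≡0 (≤-trans
            (≤-reflexive (sym (cong₂ (λ x y → b2n (x ∧ not y)) a eq)))
            (∈⇒≤∑ (λ v → b2n (adj G h v ∧ leaf v)) (∈-allFin v)))) λ ()

      from : SpiderLongLegs G Δ → #leaf-nbrs ≡ 0 × NoOtherBranch
      -- The hub of the spider and `h` both have degree at least 3, so they coincide.
      from ((_ , one-hub) , h′ , deg-h′ , long) with one-hub h′ h (subst (3 ≤_) (sym deg-h′) 3≤Δ) 3≤deg-h
      ... | refl = trans (∑-cong V λ {v} _ → none v) (trans (∑-const V 0) (*-zeroʳ (length V))) , small
        where
          none : ∀ v → b2n (adj G h v ∧ leaf v) ≡ 0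
          none v with adj G h v in a
          ... | false = refl
          ... | true = cong (b2n ∘ not) (<⇒≤ᵇ-true (long v a))
          small : NoOtherBranch
          small {u} u≢h with deg G u ≤? 2
          ... | yes p = p
          ... | no ¬p = contradiction (one-hub u h (≰⇒> ¬p) 3≤deg-h) u≢h

  -- Isomorphism with the extremal tree T_{n,Δ}

  adjTℕ-sym : ∀ i j → adjTℕ Δ i j ≡ adjTℕ Δ j i
  adjTℕ-sym zero zero = refl
  adjTℕ-sym zero (suc j) = refl
  adjTℕ-sym (suc i) zero = refl
  adjTℕ-sym (suc i) (suc j) = Bool.∨-comm (j ≡ᵇ i + Δ) (i ≡ᵇ j + Δ)

  -- With all degrees minimal, the vertices are `h`, its neighbours, and pendants at inner
  -- neighbours. They receive the labels 0, then 1 to Δ, then Δ plus the label of the neighbour that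
  -- carries the pendant.
  module Labelling (tight : #inner-nbrs ≡ k) where

    data Kind (v : Fin n) : Set where
      hub   : v ≡ h → Kind v
      nbr   : Adj G h v → Kind v
      outer : ∀ p → deg G v ≡ 1 → Adj G v p → Adj G h p → deg G p ≡ 2 → inner p ≡ true → Kind v

    outer-deg : ∀ {v} → v ≢ h → adj G h v ≡ false → deg G v ≡ 1
    outer-deg {v} v≢h eq = trans (#inner-nbrs≡k⇒min-deg tight v≢h)
      (cong (λ b → suc (b2n (b ∧ inner v))) eq)

    -- A vertex that is neither `h` nor adjacent to it is a leaf. The first step `p` of its walk to
    -- `h` must be a neighbour of `h`, since otherwise `p` would be a leaf adjacent to a leaf.
    kind : ∀ v → Kind v
    kind v with v Fin.≟ h
    ... | yes v≡h = hub v≡h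
    ... | no v≢h with adj G h v in eq
    ...   | true = nbr eq
    ...   | false with proj₁ tree v h
    ...     | here = contradiction refl v≢h
    ...     | step {v = p} a _ = outer p (outer-deg v≢h eq) a hp (≤-antisym (tight⇒no-other-branch tight p≢h) 2≤p) (<⇒≤ᵇ-true 2≤p)
      where
        p≢h : p ≢ h
        p≢h refl with () ← trans (sym eq) (adj-swap G a)
        hp : Adj G h p
        hp with adj G h p in eq′
        ... | true  = refl
        ... | false = no-adjacent-leaves G (proj₁ tree) 2≤deg-h a
          (≤-reflexive (outer-deg v≢h eq)) (≤-reflexive (outer-deg p≢h eq′))
        2≤p : 2 ≤ deg G p
        2≤p = adj₂⇒2≤deg G (v≢h ∘ sym) (adj-swap G hp) (adj-swap G a)

    -- Inner neighbours are listed first, so that those carrying pendants get the ranks below `k`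
    -- and all labels stay below `n`.
    inners leaves : List (Fin n)
    inners = selected (λ v → adj G h v ∧ inner v) V
    leaves = selected (λ v → adj G h v ∧ leaf v) V

    length-inners : length inners ≡ k
    length-inners = trans (sym (∑-b2n (λ v → adj G h v ∧ inner v) V)) tight

    length-nbrs : length (inners ++ leaves) ≡ Δ
    length-nbrs = trans (length-++ inners) (trans (+-comm (length inners) _) (trans
      (sym (cong₂ _+_ (∑-b2n (λ v → adj G h v ∧ leaf v) V) (∑-b2n (λ v → adj G h v ∧ inner v) V)))
      nbrs-split))

    member : ∀ {v} → Adj G h v → ∀ b → inner v ≡ b → v ∈ inners ++ leaves
    member {v} a true eq = ∈-++⁺ˡ (∈-selected⁺ (λ v → adj G h v ∧ inner v) (∈-allFin v) (cong₂ _∧_ a eq))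
    member {v} a false eq = ∈-++⁺ʳ inners
      (∈-selected⁺ (λ v → adj G h v ∧ leaf v) (∈-allFin v) (cong₂ (λ x y → x ∧ not y) a eq))

    rank : ∀ {v} → Adj G h v → ℕ
    rank {v} a = toℕ (index (member a (inner v) refl))

    rank-injective : ∀ {u v} (a : Adj G h u) (b : Adj G h v) → rank a ≡ rank b → u ≡ v
    rank-injective {u} {v} a b eq = index-injective (setoid (Fin n)) (member a (inner u) refl)
      (member b (inner v) refl) (Fin.toℕ-injective eq)

    -- `rank` takes an adjacency proof as argument; uniqueness of identity proofs makes the choice
    -- immaterial.
    rank-cong : ∀ {u v} (a : Adj G h u) (b : Adj G h v) → u ≡ v → rank a ≡ rank b
    rank-cong {u} a b refl = cong (rank {u}) (uip a b)

    rank<Δ : ∀ {v} (a : Adj G h v) → rank a < Δ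
    rank<Δ {v} a = subst (rank a <_) length-nbrs (Fin.toℕ<n (index (member a (inner v) refl)))

    index-++ˡ : ∀ {A : Set} {xs ys : List A} {x} (p : x ∈ xs) →
                toℕ (index (∈-++⁺ˡ {xs = xs} {ys = ys} p)) < length xs
    index-++ˡ (here _)  = s≤s z≤n
    index-++ˡ (there p) = s≤s (index-++ˡ p)

    rank<k : ∀ {v} (a : Adj G h v) → inner v ≡ true → rank a < k
    rank<k {v} a inner-v = go (inner v) refl inner-v
      where
        go : ∀ b (eq : inner v ≡ b) → b ≡ true → toℕ (index (member a b eq)) < k
        go true eq _ = subst (toℕ (index (member a true eq)) <_) length-inners
          (index-++ˡ (∈-selected⁺ (λ v → adj G h v ∧ inner v) (∈-allFin v) (cong₂ _∧_ a eq)))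

    label : ∀ {v} → Kind v → ℕ
    label (hub _)               = 0
    label (nbr a)               = suc (rank a)
    label (outer _ _ _ a _ _)   = suc (rank a + Δ)

    label<n : ∀ {v} (c : Kind v) → label c < n
    label<n c = subst (label c <_) (sym n≡) (s≤s (go c))
      where
        go : ∀ {v} (c : Kind v) → label c ≤ Δ + k
        go (hub _) = z≤n
        go (nbr a) = ≤-trans (rank<Δ a) (m≤m+n Δ k)
        go (outer _ _ _ a _ i) = ≤-trans (+-monoˡ-≤ Δ (rank<k a i)) (≤-reflexive (+-comm k Δ))

    small≢large : ∀ {x y} → x < Δ → x ≢ y + Δ
    small≢large {x} {y} x<Δ refl = <⇒≱ x<Δ (m≤n+m Δ y)

    hub≢nbr : ∀ {v} → Adj G h v → v ≢ h
    hub≢nbr a refl = adj⇒≢ G a refl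

    label-injective : ∀ {u v} (c : Kind u) (d : Kind v) → label c ≡ label d → u ≡ v
    label-injective (hub p) (hub q) _ = trans p (sym q)
    label-injective (nbr a) (nbr b) eq = rank-injective a b (suc-injective eq)
    label-injective (nbr a) (outer _ _ _ b _ _) eq =
      contradiction (suc-injective eq) (small≢large (rank<Δ a))
    label-injective (outer _ _ _ b _ _) (nbr a) eq =
      contradiction (sym (suc-injective eq)) (small≢large (rank<Δ a))
    label-injective {u} {v} (outer p du up hp dp _) (outer q dv vq hq _ _) eq
      with refl ← rank-injective hp hq (+-cancelʳ-≡ Δ _ _ (suc-injective eq)) with u Fin.≟ v
    ... | yes u≡v = u≡v
    ... | no u≢v = contradiction (≤-trans
      (adj₃⇒3≤deg G (apart up du) (apart vq dv) u≢v (adj-swap G hp) (adj-swap G up) (adj-swap G vq))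
      (≤-reflexive dp)) 1+n≰n
      where
        apart : ∀ {x} → Adj G x p → deg G x ≡ 1 → h ≢ x
        apart _ dx refl = contradiction (subst (2 ≤_) dx 2≤deg-h) λ { (s≤s ()) }

    LabelAdj : ∀ {u v} → Kind u → Kind v → Set
    LabelAdj {u} {v} c d = adj G u v ≡ adjTℕ Δ (label c) (label d)

    label-adj-swap : ∀ {u v} (c : Kind u) (d : Kind v) → LabelAdj c d → LabelAdj d c
    label-adj-swap {u} {v} c d eq = trans (Graph.sym G v u) (trans eq (adjTℕ-sym (label c) (label d)))

    label-adj-hub : ∀ {v} (d : Kind v) → LabelAdj (hub refl) d
    label-adj-hub (hub refl) = irref G h
    label-adj-hub (nbr a) = trans a (sym (cong (_∨ false) (<⇒≤ᵇ-true (rank<Δ a))))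
    label-adj-hub {v} (outer p d vp hp _ _) =
      trans hv (sym (cong (_∨ false) (≮⇒≤ᵇ-false (≤⇒≯ (m≤n+m Δ (rank hp))))))
      where
        hv : adj G h v ≡ false
        hv with adj G h v in eq
        ... | false = refl
        ... | true = contradiction (sym (deg≤1⇒unique-nbr G (≤-reflexive d) (adj-swap G eq) vp)) (hub≢nbr hp)

    label-adj-nbr-outer : ∀ {u v} (a : Adj G h u) p (d : deg G v ≡ 1) (vp : Adj G v p) (hp : Adj G h p)
                          (dp : deg G p ≡ 2) (ip : inner p ≡ true) → LabelAdj (nbr a) (outer p d vp hp dp ip)
    label-adj-nbr-outer {u} {v} a p d vp hp _ _ with u Fin.≟ p
    ... | yes refl = trans (adj-swap G vp) (sym (cong (_∨ (rank a ≡ᵇ rank hp + Δ + Δ))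
            (trans (cong (λ z → rank hp + Δ ≡ᵇ z + Δ) (rank-cong a hp refl)) (≡ᵇ-refl (rank hp + Δ)))))
    ... | no u≢p = trans uv (sym (cong₂ _∨_
            (≢⇒≡ᵇ-false λ eq → u≢p (sym (rank-injective hp a (+-cancelʳ-≡ Δ _ _ eq))))
            (≢⇒≡ᵇ-false (small≢large (rank<Δ a)))))
      where
        uv : adj G u v ≡ false
        uv with adj G u v in eq
        ... | false = refl
        ... | true = contradiction (deg≤1⇒unique-nbr G (≤-reflexive d) (adj-swap G eq) vp) u≢p

    label-adj : ∀ {u v} (c : Kind u) (d : Kind v) → LabelAdj c d
    label-adj (hub refl) d = label-adj-hub d
    label-adj c (hub refl) = label-adj-swap (hub refl) c (label-adj-hub c)
    label-adj (nbr a) (outer p d vp hp dp ip) = label-adj-nbr-outer a p d vp hp dp ip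
    label-adj (outer p d vp hp dp ip) (nbr a) =
      label-adj-swap (nbr a) (outer p d vp hp dp ip) (label-adj-nbr-outer a p d vp hp dp ip)
    label-adj {u} {v} (nbr a) (nbr b) = trans uv
      (sym (cong₂ _∨_ (≢⇒≡ᵇ-false (small≢large (rank<Δ b))) (≢⇒≡ᵇ-false (small≢large (rank<Δ a)))))
      where
        uv : adj G u v ≡ false
        uv with adj G u v in eq
        ... | false = refl
        ... | true = contradiction (h , u ∷ v ∷ [] , s≤s (s≤s z≤n) ,
            ((hub≢nbr a ∘ sym) ∷ (hub≢nbr b ∘ sym) ∷ []) ∷ (adj⇒≢ G eq ∷ []) ∷ [] ∷ [] ,
            path-linked G (a ∷ (eq ∷ stop)) (adj-swap G b)) (proj₂ tree)
    label-adj {u} {v} (outer p d up hp dp _) (outer q d′ vq hq _ _) = trans uv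
      (sym (cong₂ _∨_ (shifted hq hp) (shifted hp hq)))
      where
        shifted : ∀ {x y} (a : Adj G h x) (b : Adj G h y) → (rank a + Δ ≡ᵇ rank b + Δ + Δ) ≡ false
        shifted a b = ≢⇒≡ᵇ-false λ eq → small≢large (rank<Δ a) (+-cancelʳ-≡ Δ _ _ eq)
        uv : adj G u v ≡ false
        uv with adj G u v in eq
        ... | false = refl
        ... | true with refl ← deg≤1⇒unique-nbr G (≤-reflexive d) eq up =
          contradiction (trans (sym dp) d′) λ ()

    isomorphic : IsoTnΔ G Δ
    isomorphic = mk⤖ (injective , λ y → let x , eq = Fin-injective⇒surjective injective y in x , λ { refl → eq }) ,
      λ i j → trans (label-adj (kind i) (kind j))
        (sym (cong₂ (adjTℕ Δ) (Fin.toℕ-fromℕ< (label<n (kind i))) (Fin.toℕ-fromℕ< (label<n (kind j)))))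
      where
        φ : Fin n → Fin n
        φ v = fromℕ< (label<n (kind v))
        injective : Injective _≡_ _≡_ φ
        injective {u} {v} eq = label-injective (kind u) (kind v)
          (Fin.fromℕ<-injective _ _ (label<n (kind u)) (label<n (kind v)) eq)

  module FromIso (k<Δ : k < Δ) (iso : IsoTnΔ G Δ) where

    f : Fin n → ℕ
    f v = toℕ (Bijection.to (proj₁ iso) v)

    f-injective : ∀ {u v} → f u ≡ f v → u ≡ v
    f-injective eq = Bijection.injective (proj₁ iso) (Fin.toℕ-injective eq)

    adj-f : ∀ u v {x y} → f u ≡ x → f v ≡ y → adj G u v ≡ adjTℕ Δ x y
    adj-f u v refl refl = proj₂ iso u v

    f<2Δ : ∀ v → f v < Δ + Δ
    f<2Δ v = ≤-trans (Fin.toℕ<n (Bijection.to (proj₁ iso) v))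
      (≤-trans (≤-reflexive n≡) (≤-trans (≤-reflexive (sym (+-suc Δ k))) (+-monoʳ-≤ Δ k<Δ)))

    deg-≤-values : ∀ {u} cs → (∀ {v} → Adj G u v → f v ∈ cs) → deg G u ≤ length cs
    deg-≤-values {u} cs into = begin
      deg G u                              ≡⟨ ∑-b2n (adj G u) V ⟩
      length (selected (adj G u) V)        ≡⟨ length-map f (selected (adj G u) V) ⟨
      length (map f (selected (adj G u) V)) ≤⟨ unique-⊆⇒length≤ (Unique.map⁺ f-injective (filter⁺ _ (allFin⁺ n))) sub ⟩
      length cs                            ∎
      where
        open ≤-Reasoning
        sub : ∀ {x} → x ∈ map f (selected (adj G u) V) → x ∈ cs
        sub x∈ with v , v∈ , refl ← ∈-map⁻ f x∈ = into (proj₂ (∈-selected⁻ (adj G u) {xs = V} v∈))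

    inner-value : ∀ u {x} → f u ≡ suc x → x < Δ → deg G u ≤ 2
    inner-value u {x} fu x<Δ = deg-≤-values (0 ∷ suc (x + Δ) ∷ []) into
      where
        into : ∀ {v} → Adj G u v → f v ∈ 0 ∷ suc (x + Δ) ∷ []
        into {v} a with f v in fv
        ... | zero = here refl
        ... | suc y with ∨-true⇒ (trans (sym (adj-f u v fu fv)) a)
        ...   | inj₁ p = there (here (cong suc (≡ᵇ-true⇒≡ p)))
        ...   | inj₂ p = contradiction (subst (Δ ≤_) (sym (≡ᵇ-true⇒≡ p)) (m≤n+m Δ y)) (<⇒≱ x<Δ)

    outer-value : ∀ u {x} → f u ≡ suc x → Δ ≤ x → deg G u ≤ 1
    outer-value u {x} fu Δ≤x = deg-≤-values (suc (x ∸ Δ) ∷ []) into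
      where
        into : ∀ {v} → Adj G u v → f v ∈ suc (x ∸ Δ) ∷ []
        into {v} a with f v in fv
        ... | zero with () ← trans (sym (trans (adj-f u v fu fv)
                     (cong (_∨ false) (≮⇒≤ᵇ-false (≤⇒≯ Δ≤x))))) a
        ... | suc y with ∨-true⇒ (trans (sym (adj-f u v fu fv)) a)
        ...   | inj₁ p = contradiction (subst (_< Δ + Δ) (trans fv (cong suc (≡ᵇ-true⇒≡ p))) (f<2Δ v))
                           (≤⇒≯ (≤-trans (+-monoˡ-≤ Δ Δ≤x) (n≤1+n _)))
        ...   | inj₂ p = here (cong suc (sym (trans (cong (_∸ Δ) (≡ᵇ-true⇒≡ p)) (m+n∸n≡m y Δ))))

    f-hub : f h ≡ 0
    f-hub with f h in fh
    ... | zero = refl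
    ... | suc x with x <? Δ
    ...   | yes x<Δ = contradiction (≤-trans 3≤Δ (subst (_≤ 2) deg-h (inner-value h fh x<Δ))) 1+n≰n
    ...   | no x≮Δ = contradiction (≤-trans 3≤Δ (≤-trans (subst (_≤ 1) deg-h
                       (outer-value h fh (≮⇒≥ x≮Δ))) (n≤1+n 1))) 1+n≰n

    deg≤min-deg : ∀ {u} → u ≢ h → deg G u ≤ min-deg u
    deg≤min-deg {u} u≢h with f u in fu
    ... | zero = contradiction (f-injective (trans fu (sym f-hub))) u≢h
    ... | suc x with x <? Δ
    ...   | no x≮Δ = ≤-trans (outer-value u fu (≮⇒≥ x≮Δ)) (s≤s z≤n)
    ...   | yes x<Δ with inner u in eq
    ...     | true rewrite adj-f h u f-hub fu | <⇒≤ᵇ-true x<Δ = inner-value u fu x<Δ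
    ...     | false with deg G u ≤? 1
    ...       | yes d≤1 = ≤-trans d≤1 (s≤s z≤n)
    ...       | no d≰1 with () ← trans (sym eq) (<⇒≤ᵇ-true (≰⇒> d≰1))

  extremal⇔iso : k < Δ → (#inner-nbrs ≡ k) ⇔ IsoTnΔ G Δ
  extremal⇔iso k<Δ = mk⇔ Labelling.isomorphic
    (λ iso → min-deg⇒#inner-nbrs≡k (FromIso.deg≤min-deg k<Δ iso))

approx-replicate : ∀ N c x → approx N (replicate c x) ≡ c * root N x
approx-replicate N zero    x = refl
approx-replicate N (suc c) x = cong (root N x +_) (approx-replicate N c x)

approx-replicate₃ : ∀ N a x b y c z → approx N (replicate a x ++ replicate b y ++ replicate c z)
                    ≡ a * root N x + (b * root N y + c * root N z)
approx-replicate₃ N a x b y c z =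
  trans (∑-++ (replicate a x) _ (root N)) (cong₂ _+_ (approx-replicate N a x)
    (trans (∑-++ (replicate b y) _ (root N)) (cong₂ _+_ (approx-replicate N b y) (approx-replicate N c z))))

module _ (Δ : ℕ) (3≤Δ : 3 ≤ Δ) (N : ℕ) where
  open Weights Δ N 3≤Δ
  open ≡-Reasoning

  bound1-value : ∀ {k} j → Δ + j ≡ k →
    approx N (bound1 (suc (Δ + k)) Δ) + δ * (Δ + k) ≡ α * (Δ + k) + (0 * κ + Δ * π) + 2 * δ * k
  bound1-value {k} j refl = begin
    approx N (bound1 (suc (Δ + k)) Δ) + δ * (Δ + k)
      ≡⟨ cong (_+ δ * (Δ + k)) (approx-replicate₃ N Δ _ (suc (Δ + k) ∸ 2 * Δ ∸ 1) 8 Δ 5) ⟩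
    Δ * root N (Δ * Δ + 4) + ((suc (Δ + k) ∸ 2 * Δ ∸ 1) * root N 8 + Δ * α) + δ * (Δ + k)
      ≡⟨ cong (λ z → Δ * root N (Δ * Δ + 4) + (z * root N 8 + Δ * α) + δ * (Δ + k)) count ⟩
    Δ * root N (Δ * Δ + 4) + (j * root N 8 + Δ * α) + δ * (Δ + k)
      ≡⟨ cong₂ (λ x y → Δ * x + (j * y + Δ * α) + δ * (Δ + k)) α+π α+δ ⟨
    Δ * (α + π) + (j * (α + δ) + Δ * α) + δ * (Δ + (Δ + j))
      ≡⟨ ring Δ j α δ π ⟩
    α * (Δ + k) + (0 + Δ * π) + 2 * δ * k ∎
    where
      count : suc (Δ + (Δ + j)) ∸ 2 * Δ ∸ 1 ≡ j
      count = trans (cong (λ z → z ∸ 2 * Δ ∸ 1) (e Δ j)) (cong (_∸ 1) (m+n∸m≡n (2 * Δ) (suc j)))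
        where
          e : ∀ d j → suc (d + (d + j)) ≡ 2 * d + suc j
          e = solve-∀
      ring : ∀ D j a d p → D * (a + p) + (j * (a + d) + D * a) + d * (D + (D + j))
             ≡ a * (D + (D + j)) + (0 + D * p) + 2 * d * (D + j)
      ring = solve-∀

  bound2-value : ∀ k i → Δ ≡ k + i →
    approx N (bound2 (suc (Δ + k)) Δ) + δ * (Δ + k) ≡ α * (Δ + k) + (i * κ + k * π) + 2 * δ * k
  bound2-value k i Δ≡ = begin
    approx N (bound2 (suc (Δ + k)) Δ) + δ * (Δ + k)
      ≡⟨ cong (_+ δ * (Δ + k)) (approx-replicate₃ N (suc (Δ + k) ∸ Δ ∸ 1) _
           (2 * Δ + 1 ∸ suc (Δ + k)) _ (suc (Δ + k) ∸ Δ ∸ 1) 5) ⟩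
    (suc (Δ + k) ∸ Δ ∸ 1) * P + ((2 * Δ + 1 ∸ suc (Δ + k)) * Q + (suc (Δ + k) ∸ Δ ∸ 1) * α) + δ * (Δ + k)
      ≡⟨ cong₂ (λ x y → x * P + (y * Q + x * α) + δ * (Δ + k)) count₁ count₂ ⟩
    k * P + (i * Q + k * α) + δ * (Δ + k)
      ≡⟨ cong₂ (λ x y → k * x + (i * Q + k * α) + δ * (y + k)) α+π (sym Δ≡) ⟨
    k * (α + π) + (i * Q + k * α) + δ * (k + i + k)
      ≡⟨ e₁ k i α π Q δ ⟩
    i * (Q + δ) + (k * (α + π) + k * α + 2 * δ * k)
      ≡⟨ cong (λ z → i * z + (k * (α + π) + k * α + 2 * δ * k)) α+κ ⟨
    i * (α + κ) + (k * (α + π) + k * α + 2 * δ * k)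
      ≡⟨ e₂ k i α π κ δ ⟩
    α * (k + i + k) + (i * κ + k * π) + 2 * δ * k
      ≡⟨ cong (λ y → α * (y + k) + (i * κ + k * π) + 2 * δ * k) Δ≡ ⟨
    α * (Δ + k) + (i * κ + k * π) + 2 * δ * k ∎
    where
      P = root N (Δ * Δ + 4)
      Q = root N (Δ * Δ + 1)
      count₁ : suc (Δ + k) ∸ Δ ∸ 1 ≡ k
      count₁ = trans (cong (λ z → z ∸ Δ ∸ 1) (sym (+-suc Δ k))) (cong (_∸ 1) (m+n∸m≡n Δ (suc k)))
      count₂ : 2 * Δ + 1 ∸ suc (Δ + k) ≡ i
      count₂ = trans (cong (λ z → 2 * z + 1 ∸ suc (z + k)) Δ≡)
        (trans (cong (_∸ suc (k + i + k)) (e k i)) (m+n∸m≡n (suc (k + i + k)) i))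
        where
          e : ∀ k i → 2 * (k + i) + 1 ≡ suc (k + i + k) + i
          e = solve-∀
      e₁ : ∀ k i a p Q d → k * (a + p) + (i * Q + k * a) + d * (k + i + k)
           ≡ i * (Q + d) + (k * (a + p) + k * a + 2 * d * k)
      e₁ = solve-∀
      e₂ : ∀ k i a p κ d → i * (a + κ) + (k * (a + p) + k * a + 2 * d * k)
           ≡ a * (k + i + k) + (i * κ + k * p) + 2 * d * k
      e₂ = solve-∀

theorem1p1 : (n Δ : ℕ) (T : Graph n) → 7 ≤ n → IsTree T → MaxDegree T Δ →
    3 ≤ Δ → Δ ≤ n ∸ 2 →
    (Δ ≤ (n ∸ 1) / 2 →
    (bound1 n Δ ≤√ SO T) × ((SO T ≈√ bound1 n Δ) ⇔ SpiderLongLegs T Δ))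
    × ((n ∸ 1) / 2 < Δ →
    (bound2 n Δ ≤√ SO T) × ((SO T ≈√ bound2 n Δ) ⇔ IsoTnΔ T Δ))
theorem1p1 n@(suc m) Δ T 7≤n tree ((h , deg-h) , _) 3≤Δ Δ≤n-2 = part₁ , part₂
  where
    k = m ∸ Δ
    Δ+k≡m : Δ + k ≡ m
    Δ+k≡m = m+[n∸m]≡n (≤-trans Δ≤n-2 (m∸n≤m m 1))

    open Extremal T tree h Δ k (cong suc (sym Δ+k≡m)) deg-h 3≤Δ
    open TreeSums T tree h Δ k (cong suc (sym Δ+k≡m)) deg-h 3≤Δ

    part₁ : Δ ≤ m / 2 → (bound1 n Δ ≤√ SO T) × ((SO T ≈√ bound1 n Δ) ⇔ SpiderLongLegs T Δ)
    part₁ Δ≤ = lower-bound ,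
      mk⇔ (λ eq → Equivalence.to no-leaf-nbrs⇔ (equality⇒ (proj₁ eq)))
          (λ s → let none , small = Equivalence.from no-leaf-nbrs⇔ s in ⇒equality none small)
      where
        Δ≤k : Δ ≤ k
        Δ≤k = +-cancelˡ-≤ Δ _ _ (begin
          Δ + Δ          ≡⟨ e Δ ⟩
          Δ * 2          ≤⟨ *-monoˡ-≤ 2 Δ≤ ⟩
          m / 2 * 2      ≤⟨ m/n*n≤m m 2 ⟩
          m              ≡⟨ Δ+k≡m ⟨
          Δ + k          ∎)
          where
            open ≤-Reasoning
            e : ∀ d → d + d ≡ d * 2
            e = solve-∀
        value : HasValue Δ k 3≤Δ (bound1 n Δ) 0 Δ
        value = subst (λ z → HasValue Δ k 3≤Δ (bound1 (suc z) Δ) 0 Δ) Δ+k≡m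
          (λ N → bound1-value Δ 3≤Δ N (k ∸ Δ) (m+[n∸m]≡n Δ≤k))
        open Bound (bound1 n Δ) 0 Δ #leaf-nbrs refl (trans (+-comm #inner-nbrs _) nbrs-split) value

    part₂ : m / 2 < Δ → (bound2 n Δ ≤√ SO T) × ((SO T ≈√ bound2 n Δ) ⇔ IsoTnΔ T Δ)
    part₂ <Δ = lower-bound ,
      mk⇔ (λ eq → Equivalence.to (extremal⇔iso k<Δ) (≤-antisym #inner-nbrs≤k (m∸n≡0⇒m≤n (proj₁ (equality⇒ (proj₁ eq))))))
          (λ iso → let tight = Equivalence.from (extremal⇔iso k<Δ) iso in
                   ⇒equality (trans (cong (k ∸_) tight) (n∸n≡0 k)) (tight⇒no-other-branch tight))
      where
        k<Δ : k < Δ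
        k<Δ = ≰⇒> λ Δ≤k → <⇒≱ <Δ (begin
          Δ            ≡⟨ m*n/n≡m Δ 2 ⟨
          Δ * 2 / 2    ≤⟨ /-monoˡ-≤ 2 (≤-trans (≤-reflexive (e Δ)) (≤-trans (+-monoʳ-≤ Δ Δ≤k) (≤-reflexive Δ+k≡m))) ⟩
          m / 2        ∎)
          where
            open ≤-Reasoning
            e : ∀ d → d * 2 ≡ d + d
            e = solve-∀
        i = Δ ∸ k
        inner+excess : #inner-nbrs + (k ∸ #inner-nbrs) ≡ k
        inner+excess = m+[n∸m]≡n #inner-nbrs≤k
        leaves≡ : i + (k ∸ #inner-nbrs) ≡ #leaf-nbrs
        leaves≡ = +-cancelʳ-≡ #inner-nbrs _ _ (trans (+-assoc i _ _) (trans
          (cong (i +_) (trans (+-comm (k ∸ #inner-nbrs) _) inner+excess))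
          (trans (m∸n+n≡m (<⇒≤ k<Δ)) (sym nbrs-split))))
        value : HasValue Δ k 3≤Δ (bound2 n Δ) i k
        value = subst (λ z → HasValue Δ k 3≤Δ (bound2 (suc z) Δ) i k) Δ+k≡m
          (λ N → bound2-value Δ 3≤Δ N k i (sym (m+[n∸m]≡n (<⇒≤ k<Δ))))
        open Bound (bound2 n Δ) i k (k ∸ #inner-nbrs) leaves≡ inner+excess value
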